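{- Let $k\ge 0$ be an integer and let $G$ be a graph with $m$ edges, where $m\ge\max\{(k^2+2k+2)^2+k+1,\,(2k+3)^2+k+1\}$. If $\rho(G)\ge\sqrt{m-k}$, then $G$ contains $K_{1,m-k}$ as a subgraph or $G$ contains $C_4$ as a subgraph.
   Context: All graphs are finite, simple and undirected. $\rho(G)$ denotes the spectral radius (largest eigenvalue) of the adjacency matrix $A(G)$ of $G$. $K_{1,t}$ denotes the star with $t$ edges (on $t+1$ vertices) and $C_4$ the cycle on $4$ vertices. "Contains as a subgraph" means not necessarily induced. -}

module Defs where

open import Data.Bool.Base using (Bool; true; false; if_then_else_; _∨_)
open import Data.Bool.Properties using (∨-comm)
import Data.Bool.Properties as Bool
open import Data.Fin.Base using (Fin; zero; suc; toℕ)
import Data.Fin.Properties as Fin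
open import Data.Integer.Base using (+_; +[1+_]; +≤+; +<+)
import Data.Integer.Base as ℤ
import Data.Integer.Properties as ℤ
open import Data.List.Base using (List; length; filter; cartesianProduct; allFin)
open import Data.Nat.Base as ℕ using (ℕ; zero; suc; s≤s; z≤n)
import Data.Nat.DivMod as ℕ
import Data.Nat.Properties as ℕ
import Data.Nat.Tactic.RingSolver as ℕ-Ring
open import Data.Product.Base using (Σ; ∃; _×_; _,_)
open import Data.Rational.Base using (ℚ; mkℚ; 0ℚ; 1ℚ; ½; ∣_∣; toℚᵘ; Positive; NonZero; positive; nonNegative; 1/_; *<*)
import Data.Rational.Base as ℚ
import Data.Rational.Properties as ℚ
open import Data.Rational.Solver using (module +-*-Solver)
open import Data.Rational.Unnormalised.Base using (mkℚᵘ)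
import Data.Rational.Unnormalised.Base as ℚᵘ
import Data.Rational.Unnormalised.Properties as ℚᵘ
open import Data.Vec.Functional using (Vector; foldr)
open import Data.Sum.Base using (inj₁; inj₂)
open import Function.Definitions using (Injective)
open import Relation.Binary.PropositionalEquality using (_≡_; refl; sym; trans; cong; cong₂; subst; subst₂)
open import Relation.Nullary using (¬_; yes; no; does)
open import Relation.Nullary.Decidable using (_×-dec_)

------------------------------------------------------------------------
-- Real numbers: Cauchy sequences of rationals, with the equality _≈_

Eventually : (ℕ → Set) → Set
Eventually P = ∃ λ N → ∀ n → N ℕ.≤ n → P n

record ℝ : Set where
  constructor mkℝ
  field
    seq    : ℕ → ℚ
    cauchy : ∀ ε → 0ℚ ℚ.< ε →
             ∃ λ N → ∀ i j → N ℕ.≤ i → N ℕ.≤ j → ∣ seq i ℚ.- seq j ∣ ℚ.≤ ε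

open ℝ public

infix 4 _≈_ _≤_ _≥_

_≈_ : ℝ → ℝ → Set
x ≈ y = ∀ ε → 0ℚ ℚ.< ε → Eventually λ n → ∣ seq x n ℚ.- seq y n ∣ ℚ.≤ ε

_≤_ : ℝ → ℝ → Set
x ≤ y = ∀ ε → 0ℚ ℚ.< ε → Eventually λ n → seq x n ℚ.≤ seq y n ℚ.+ ε

_≥_ : ℝ → ℝ → Set
x ≥ y = y ≤ x

fromℚ : ℚ → ℝ
fromℚ q = mkℝ (λ _ → q) λ ε 0<ε → 0 , λ _ _ _ _ →
  subst (λ d → ∣ d ∣ ℚ.≤ ε) (sym (ℚ.+-inverseʳ q)) (ℚ.<⇒≤ 0<ε)

fromℕ : ℕ → ℝ
fromℕ n = fromℚ (+ n ℚ./ 1)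

0ℝ 1ℝ : ℝ
0ℝ = fromℚ 0ℚ
1ℝ = fromℚ 1ℚ

private
  ⊔≤ˡ : ∀ m n {o} → m ℕ.⊔ n ℕ.≤ o → m ℕ.≤ o
  ⊔≤ˡ m n = ℕ.m⊔n≤o⇒m≤o m n

  ⊔≤ʳ : ∀ m n {o} → m ℕ.⊔ n ℕ.≤ o → n ℕ.≤ o
  ⊔≤ʳ m n = ℕ.m⊔n≤o⇒n≤o m n

  0<½* : ∀ {ε} → 0ℚ ℚ.< ε → 0ℚ ℚ.< ε ℚ.* ½
  0<½* {ε} 0<ε = ℚ.positive⁻¹ (ε ℚ.* ½) {{ℚ.pos*pos⇒pos ε {{positive 0<ε}} ½}}

  halves : ∀ ε → ε ℚ.* ½ ℚ.+ ε ℚ.* ½ ≡ ε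
  halves ε = trans (sym (ℚ.*-distribˡ-+ ε ½ ½)) (ℚ.*-identityʳ ε)

  *-mono-≤ : ∀ {a b c d} → 0ℚ ℚ.≤ c → 0ℚ ℚ.≤ b → a ℚ.≤ b → c ℚ.≤ d → a ℚ.* c ℚ.≤ b ℚ.* d
  *-mono-≤ {a} {b} {c} {d} 0≤c 0≤b a≤b c≤d = ℚ.≤-trans
    (ℚ.*-monoʳ-≤-nonNeg c {{nonNegative 0≤c}} a≤b)
    (ℚ.*-monoˡ-≤-nonNeg b {{nonNegative 0≤b}} c≤d)

  -- Division by a positive rational, packaged to avoid instance arguments.
  divide : ∀ ε K → 0ℚ ℚ.< ε → 0ℚ ℚ.< K → ∃ λ δ → 0ℚ ℚ.< δ × δ ℚ.* K ≡ ε
  divide ε K 0<ε 0<K = ε ℚ.* 1/ K , ℚ.positive⁻¹ _ {{ℚ.pos*pos⇒pos ε (1/ K)}} ,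
    trans (ℚ.*-assoc ε (1/ K) K) (trans (cong (ε ℚ.*_) (ℚ.*-inverseˡ K)) (ℚ.*-identityʳ ε))
    where instance
      ε>0 : Positive ε
      ε>0 = positive 0<ε
      K>0 : Positive K
      K>0 = positive 0<K
      K≢0 : NonZero K
      K≢0 = ℚ.pos⇒nonZero K
      1/K>0 : Positive (1/ K)
      1/K>0 = ℚ.1/pos⇒pos K

  bound : ∀ x → ∃ λ B → 0ℚ ℚ.< B × Eventually λ n → ∣ seq x n ∣ ℚ.≤ B
  bound x with cauchy x 1ℚ (ℚ.positive⁻¹ 1ℚ)
  ... | N , h = 1ℚ ℚ.+ ∣ seq x N ∣
              , ℚ.+-mono-<-≤ (ℚ.positive⁻¹ 1ℚ) (ℚ.0≤∣p∣ (seq x N))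
              , N , λ n N≤n → ℚ.≤-trans
                  (subst (λ a → ∣ a ∣ ℚ.≤ ∣ seq x n ℚ.- seq x N ∣ ℚ.+ ∣ seq x N ∣) (split (seq x n) (seq x N))
                    (ℚ.∣p+q∣≤∣p∣+∣q∣ (seq x n ℚ.- seq x N) (seq x N)))
                  (ℚ.+-monoˡ-≤ ∣ seq x N ∣ (h n N N≤n ℕ.≤-refl))
    where
    open +-*-Solver
    split : ∀ a b → (a ℚ.- b) ℚ.+ b ≡ a
    split = solve 2 (λ a b → (a :- b) :+ b := a) refl

infixl 6 _+_
infixl 7 _*_

_+_ : ℝ → ℝ → ℝ
seq (x + y) n = seq x n ℚ.+ seq y n
cauchy (x + y) ε 0<ε
  with cauchy x (ε ℚ.* ½) (0<½* 0<ε) | cauchy y (ε ℚ.* ½) (0<½* 0<ε)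
... | M , f | N , g = M ℕ.⊔ N , λ i j p q →
  subst₂ (λ a b → ∣ a ∣ ℚ.≤ b) (regroup (seq x i) (seq x j) (seq y i) (seq y j)) (halves ε)
    (ℚ.≤-trans (ℚ.∣p+q∣≤∣p∣+∣q∣ (seq x i ℚ.- seq x j) (seq y i ℚ.- seq y j))
      (ℚ.+-mono-≤ (f i j (⊔≤ˡ M N p) (⊔≤ˡ M N q))
                  (g i j (⊔≤ʳ M N p) (⊔≤ʳ M N q))))
  where
  open +-*-Solver
  regroup : ∀ a b c d → (a ℚ.- b) ℚ.+ (c ℚ.- d) ≡ (a ℚ.+ c) ℚ.- (b ℚ.+ d)
  regroup = solve 4 (λ a b c d → (a :- b) :+ (c :- d) := (a :+ c) :- (b :+ d)) refl

private
  product-close : ∀ a b c d {B C δ} → 0ℚ ℚ.≤ δ →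
                  ∣ a ℚ.- b ∣ ℚ.≤ δ → ∣ c ℚ.- d ∣ ℚ.≤ δ → ∣ b ∣ ℚ.≤ B → ∣ c ∣ ℚ.≤ C →
                  ∣ a ℚ.* c ℚ.- b ℚ.* d ∣ ℚ.≤ δ ℚ.* (C ℚ.+ B)
  product-close a b c d {B} {C} {δ} 0≤δ ab cd bB cC = begin
    ∣ a ℚ.* c ℚ.- b ℚ.* d ∣
      ≡⟨ cong ∣_∣ (sym (regroup a b c d)) ⟩
    ∣ (a ℚ.- b) ℚ.* c ℚ.+ (c ℚ.- d) ℚ.* b ∣
      ≤⟨ ℚ.∣p+q∣≤∣p∣+∣q∣ ((a ℚ.- b) ℚ.* c) ((c ℚ.- d) ℚ.* b) ⟩
    ∣ (a ℚ.- b) ℚ.* c ∣ ℚ.+ ∣ (c ℚ.- d) ℚ.* b ∣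
      ≡⟨ cong₂ ℚ._+_ (ℚ.∣p*q∣≡∣p∣*∣q∣ (a ℚ.- b) c) (ℚ.∣p*q∣≡∣p∣*∣q∣ (c ℚ.- d) b) ⟩
    ∣ a ℚ.- b ∣ ℚ.* ∣ c ∣ ℚ.+ ∣ c ℚ.- d ∣ ℚ.* ∣ b ∣
      ≤⟨ ℚ.+-mono-≤ (*-mono-≤ (ℚ.0≤∣p∣ c) 0≤δ ab cC) (*-mono-≤ (ℚ.0≤∣p∣ b) 0≤δ cd bB) ⟩
    δ ℚ.* C ℚ.+ δ ℚ.* B
      ≡⟨ sym (ℚ.*-distribˡ-+ δ C B) ⟩
    δ ℚ.* (C ℚ.+ B) ∎
    where
    open ℚ.≤-Reasoning
    regroup : ∀ a b c d → (a ℚ.- b) ℚ.* c ℚ.+ (c ℚ.- d) ℚ.* b ≡ a ℚ.* c ℚ.- b ℚ.* d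
    regroup = solve 4 (λ a b c d → (a :- b) :* c :+ (c :- d) :* b := a :* c :- b :* d) refl
      where open +-*-Solver

_*_ : ℝ → ℝ → ℝ
seq (x * y) n = seq x n ℚ.* seq y n
cauchy (x * y) ε 0<ε =
  let B , 0<B , K , b = bound x
      C , 0<C , L , c = bound y
      δ , 0<δ , δ*≡ε  = divide ε (C ℚ.+ B) 0<ε (ℚ.+-mono-< 0<C 0<B)
      M , f           = cauchy x δ 0<δ
      N , g           = cauchy y δ 0<δ
  in (K ℕ.⊔ L) ℕ.⊔ (M ℕ.⊔ N) , λ i j p q →
  subst (∣ seq x i ℚ.* seq y i ℚ.- seq x j ℚ.* seq y j ∣ ℚ.≤_) δ*≡ε
    (product-close (seq x i) (seq x j) (seq y i) (seq y j) (ℚ.<⇒≤ 0<δ)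
      (f i j (⊔≤ˡ M N (⊔≤ʳ (K ℕ.⊔ L) (M ℕ.⊔ N) p)) (⊔≤ˡ M N (⊔≤ʳ (K ℕ.⊔ L) (M ℕ.⊔ N) q)))
      (g i j (⊔≤ʳ M N (⊔≤ʳ (K ℕ.⊔ L) (M ℕ.⊔ N) p)) (⊔≤ʳ M N (⊔≤ʳ (K ℕ.⊔ L) (M ℕ.⊔ N) q)))
      (b j (⊔≤ˡ K L (⊔≤ˡ (K ℕ.⊔ L) (M ℕ.⊔ N) q)))
      (c i (⊔≤ʳ K L (⊔≤ˡ (K ℕ.⊔ L) (M ℕ.⊔ N) p))))

------------------------------------------------------------------------
-- Square roots of natural numbers

⌊√_⌋ : ℕ → ℕ
⌊√ zero ⌋ = 0
⌊√ suc n ⌋ with suc ⌊√ n ⌋ ℕ.* suc ⌊√ n ⌋ ℕ.≤? suc n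
... | yes _ = suc ⌊√ n ⌋
... | no  _ = ⌊√ n ⌋

⌊√⌋-lower : ∀ n → ⌊√ n ⌋ ℕ.* ⌊√ n ⌋ ℕ.≤ n
⌊√⌋-lower zero = z≤n
⌊√⌋-lower (suc n) with suc ⌊√ n ⌋ ℕ.* suc ⌊√ n ⌋ ℕ.≤? suc n
... | yes p = p
... | no  _ = ℕ.m≤n⇒m≤1+n (⌊√⌋-lower n)

⌊√⌋-upper : ∀ n → n ℕ.< suc ⌊√ n ⌋ ℕ.* suc ⌊√ n ⌋
⌊√⌋-upper zero = s≤s z≤n
⌊√⌋-upper (suc n) with suc ⌊√ n ⌋ ℕ.* suc ⌊√ n ⌋ ℕ.≤? suc n
... | yes _ = ℕ.≤-<-trans (⌊√⌋-upper n) (ℕ.*-mono-< (ℕ.n<1+n (suc ⌊√ n ⌋)) (ℕ.n<1+n (suc ⌊√ n ⌋)))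
... | no ¬p = ℕ.≰⇒> ¬p

private
  √num : ℕ → ℕ → ℕ
  √num n j = ⌊√ n ℕ.* (suc j ℕ.* suc j) ⌋

  √seq : ℕ → ℕ → ℚ
  √seq n j = + √num n j ℚ./ suc j

  1/suc : ℕ → ℚ
  1/suc j = + 1 ℚ./ suc j

  1/suc-vanishes : ∀ ε → 0ℚ ℚ.< ε → Eventually λ j → 1/suc j ℚ.≤ ε
  1/suc-vanishes (mkℚ +[1+ p ] d _) _ = d , λ j d≤j → ℚ.toℚᵘ-cancel-≤
    (ℚᵘ.≤-respˡ-≃ (ℚᵘ.≃-sym (ℚ.toℚᵘ-fromℚᵘ (mkℚᵘ (+ 1) j)))
      (ℚᵘ.*≤* (subst₂ ℤ._≤_ (ℤ.pos-* 1 (suc d)) (ℤ.pos-* (suc p) (suc j))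
        (+≤+ (ℕ.*-mono-≤ {1} {suc p} (s≤s z≤n) (s≤s d≤j))))))
  1/suc-vanishes (mkℚ (+ 0) _ _) (*<* (+<+ ()))
  1/suc-vanishes (mkℚ ℤ.-[1+ _ ] _ _) (*<* ())

  square-cancel-< : ∀ {a b} → a ℕ.* a ℕ.< b ℕ.* b → a ℕ.< b
  square-cancel-< {a} {b} lt with a ℕ.<? b
  ... | yes p = p
  ... | no ¬p with () ← ℕ.<⇒≱ lt (ℕ.*-mono-≤ (ℕ.≮⇒≥ ¬p) (ℕ.≮⇒≥ ¬p))

  √num-cross : ∀ n i j → √num n i ℕ.* suc j ℕ.< suc (√num n j) ℕ.* suc i
  √num-cross n i j = square-cancel-< (begin-strict
    (a ℕ.* J) ℕ.* (a ℕ.* J)         ≡⟨ r₁ a J ⟩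
    (a ℕ.* a) ℕ.* (J ℕ.* J)         ≤⟨ ℕ.*-monoˡ-≤ (J ℕ.* J) (⌊√⌋-lower (n ℕ.* (I ℕ.* I))) ⟩
    (n ℕ.* (I ℕ.* I)) ℕ.* (J ℕ.* J) ≡⟨ r₂ n I J ⟩
    (n ℕ.* (J ℕ.* J)) ℕ.* (I ℕ.* I) <⟨ ℕ.*-monoˡ-< (I ℕ.* I) (⌊√⌋-upper (n ℕ.* (J ℕ.* J))) ⟩
    (b ℕ.* b) ℕ.* (I ℕ.* I)         ≡⟨ r₁ b I ⟨
    (b ℕ.* I) ℕ.* (b ℕ.* I)         ∎)
    where
    open ℕ.≤-Reasoning
    I = suc i
    J = suc j
    a = √num n i
    b = suc (√num n j)
    r₁ : ∀ x y → (x ℕ.* y) ℕ.* (x ℕ.* y) ≡ (x ℕ.* x) ℕ.* (y ℕ.* y)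
    r₁ = ℕ-Ring.solve-∀
    r₂ : ∀ x y z → (x ℕ.* (y ℕ.* y)) ℕ.* (z ℕ.* z) ≡ (x ℕ.* (z ℕ.* z)) ℕ.* (y ℕ.* y)
    r₂ = ℕ-Ring.solve-∀

  √seq+1/suc : ∀ n j → √seq n j ℚ.+ 1/suc j ≡ + suc (√num n j) ℚ./ suc j
  √seq+1/suc n j = ℚ.toℚᵘ-injective (begin
    toℚᵘ (√seq n j ℚ.+ 1/suc j)            ≈⟨ ℚ.toℚᵘ-homo-+ (√seq n j) (1/suc j) ⟩
    toℚᵘ (√seq n j) ℚᵘ.+ toℚᵘ (1/suc j)    ≈⟨ ℚᵘ.+-cong (ℚ.toℚᵘ-fromℚᵘ (mkℚᵘ (+ a) j)) (ℚ.toℚᵘ-fromℚᵘ (mkℚᵘ (+ 1) j)) ⟩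
    mkℚᵘ (+ a) j ℚᵘ.+ mkℚᵘ (+ 1) j         ≈⟨ ℚᵘ.*≡* eq ⟩
    mkℚᵘ (+ suc a) j                       ≈⟨ ℚ.toℚᵘ-fromℚᵘ (mkℚᵘ (+ suc a) j) ⟨
    toℚᵘ (+ suc a ℚ./ suc j)               ∎)
    where
    open ℚᵘ.≃-Reasoning
    a = √num n j
    eq : (+ a ℤ.* + suc j ℤ.+ + 1 ℤ.* + suc j) ℤ.* + suc j ≡ + suc a ℤ.* (+ suc j ℤ.* + suc j)
    eq = trans (cong (ℤ._* + suc j) (sym (ℤ.*-distribʳ-+ (+ suc j) (+ a) (+ 1))))
         (trans (ℤ.*-assoc (+ a ℤ.+ + 1) (+ suc j) (+ suc j))
                (cong (λ t → + t ℤ.* (+ suc j ℤ.* + suc j)) (ℕ.+-comm a 1)))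

  frac-≤ : ∀ a i b j → a ℕ.* suc j ℕ.≤ b ℕ.* suc i → + a ℚ./ suc i ℚ.≤ + b ℚ./ suc j
  frac-≤ a i b j le = ℚ.toℚᵘ-cancel-≤
    (ℚᵘ.≤-respˡ-≃ (ℚᵘ.≃-sym (ℚ.toℚᵘ-fromℚᵘ (mkℚᵘ (+ a) i)))
    (ℚᵘ.≤-respʳ-≃ (ℚᵘ.≃-sym (ℚ.toℚᵘ-fromℚᵘ (mkℚᵘ (+ b) j)))
      (ℚᵘ.*≤* (subst₂ ℤ._≤_ (ℤ.pos-* a (suc j)) (ℤ.pos-* b (suc i)) (+≤+ le)))))

  √seq-close : ∀ n i j → √seq n i ℚ.≤ √seq n j ℚ.+ 1/suc j
  √seq-close n i j = subst (√seq n i ℚ.≤_) (sym (√seq+1/suc n j))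
    (frac-≤ (√num n i) i (suc (√num n j)) j (ℕ.<⇒≤ (√num-cross n i j)))

  ≤+⇒-≤ : ∀ a b c → a ℚ.≤ b ℚ.+ c → a ℚ.- b ℚ.≤ c
  ≤+⇒-≤ a b c le = subst (a ℚ.- b ℚ.≤_) (r b c) (ℚ.+-monoˡ-≤ (ℚ.- b) le)
    where
    open +-*-Solver
    r : ∀ b c → b ℚ.+ c ℚ.- b ≡ c
    r = solve 2 (λ b c → b :+ c :- b := c) refl

  ∣-∣≤ : ∀ a b ε → a ℚ.≤ b ℚ.+ ε → b ℚ.≤ a ℚ.+ ε → ∣ a ℚ.- b ∣ ℚ.≤ ε
  ∣-∣≤ a b ε p q with ℚ.∣p∣≡p∨∣p∣≡-p (a ℚ.- b)
  ... | inj₁ e = subst (ℚ._≤ ε) (sym e) (≤+⇒-≤ a b ε p)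
  ... | inj₂ e = subst (ℚ._≤ ε) (sym (trans e (r a b))) (≤+⇒-≤ b a ε q)
    where
    open +-*-Solver
    r : ∀ a b → ℚ.- (a ℚ.- b) ≡ b ℚ.- a
    r = solve 2 (λ a b → :- (a :- b) := b :- a) refl

-- The j-th approximation is ⌊ √n · (j + 1) ⌋ / (j + 1).
√_ : ℕ → ℝ
seq (√ n) j = + ⌊√ n ℕ.* (suc j ℕ.* suc j) ⌋ ℚ./ suc j
cauchy (√ n) ε 0<ε with 1/suc-vanishes ε 0<ε
... | N , h = N , λ i j p q → ∣-∣≤ (√seq n i) (√seq n j) ε
  (ℚ.≤-trans (√seq-close n i j) (ℚ.+-monoʳ-≤ (√seq n j) (h j q)))
  (ℚ.≤-trans (√seq-close n j i) (ℚ.+-monoʳ-≤ (√seq n i) (h i p)))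

√-nonNeg : ∀ n → 0ℝ ≤ √ n
√-nonNeg n ε 0<ε = 0 , λ j _ → ℚ.≤-trans (ℚ.<⇒≤ 0<ε)
  (subst (ℚ._≤ √seq n j ℚ.+ ε) (ℚ.+-identityˡ ε)
    (ℚ.+-monoˡ-≤ ε (frac-≤ 0 0 (√num n j) j z≤n)))

private
  frac-square : ∀ a j → (+ a ℚ./ suc j) ℚ.* (+ a ℚ./ suc j) ≡ + (a ℕ.* a) ℚ./ (suc j ℕ.* suc j)
  frac-square a j = ℚ.toℚᵘ-injective (begin
    toℚᵘ (q ℚ.* q)                          ≈⟨ ℚ.toℚᵘ-homo-* q q ⟩
    toℚᵘ q ℚᵘ.* toℚᵘ q                      ≈⟨ ℚᵘ.*-cong qᵘ qᵘ ⟩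
    mkℚᵘ (+ a) j ℚᵘ.* mkℚᵘ (+ a) j          ≈⟨ ℚᵘ.*≡* (cong (ℤ._* (+ suc j ℤ.* + suc j)) (sym (ℤ.pos-* a a))) ⟩
    mkℚᵘ (+ (a ℕ.* a)) (j ℕ.+ j ℕ.* suc j)  ≈⟨ ℚ.toℚᵘ-fromℚᵘ (mkℚᵘ (+ (a ℕ.* a)) (j ℕ.+ j ℕ.* suc j)) ⟨
    toℚᵘ (+ (a ℕ.* a) ℚ./ (suc j ℕ.* suc j)) ∎)
    where
    open ℚᵘ.≃-Reasoning
    q = + a ℚ./ suc j
    qᵘ : toℚᵘ q ℚᵘ.≃ mkℚᵘ (+ a) j
    qᵘ = ℚ.toℚᵘ-fromℚᵘ (mkℚᵘ (+ a) j)

  √seq-lower : ∀ n j → √seq n j ℚ.* √seq n j ℚ.≤ + n ℚ./ 1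
  √seq-lower n j = subst (ℚ._≤ + n ℚ./ 1) (sym (frac-square (√num n j) j))
    (frac-≤ (√num n j ℕ.* √num n j) (j ℕ.+ j ℕ.* suc j) n 0
      (subst (ℕ._≤ n ℕ.* (suc j ℕ.* suc j)) (sym (ℕ.*-identityʳ _)) (⌊√⌋-lower (n ℕ.* (suc j ℕ.* suc j)))))

  √seq-upper : ∀ n j → + n ℚ./ 1 ℚ.≤ (√seq n j ℚ.+ 1/suc j) ℚ.* (√seq n j ℚ.+ 1/suc j)
  √seq-upper n j = subst (+ n ℚ./ 1 ℚ.≤_)
    (sym (trans (cong (λ q → q ℚ.* q) (√seq+1/suc n j)) (frac-square (suc (√num n j)) j)))
    (frac-≤ n 0 (suc (√num n j) ℕ.* suc (√num n j)) (j ℕ.+ j ℕ.* suc j)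
      (subst (n ℕ.* (suc j ℕ.* suc j) ℕ.≤_) (sym (ℕ.*-identityʳ _)) (ℕ.<⇒≤ (⌊√⌋-upper (n ℕ.* (suc j ℕ.* suc j))))))

  expand-≤ : ∀ {s d B δ q} → 0ℚ ℚ.≤ s → 0ℚ ℚ.≤ d → 0ℚ ℚ.≤ δ → s ℚ.≤ B → d ℚ.≤ 1ℚ → d ℚ.≤ δ →
             q ℚ.≤ (s ℚ.+ d) ℚ.* (s ℚ.+ d) → q ℚ.≤ s ℚ.* s ℚ.+ δ ℚ.* ((B ℚ.+ B) ℚ.+ 1ℚ)
  expand-≤ {s} {d} {B} {δ} {q} 0≤s 0≤d 0≤δ s≤B d≤1 d≤δ q≤ = begin
    q                                     ≤⟨ q≤ ⟩
    (s ℚ.+ d) ℚ.* (s ℚ.+ d)               ≡⟨ expand s d ⟩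
    s ℚ.* s ℚ.+ d ℚ.* ((s ℚ.+ s) ℚ.+ d)   ≤⟨ ℚ.+-monoʳ-≤ (s ℚ.* s)
                                              (*-mono-≤ (ℚ.+-mono-≤ (ℚ.+-mono-≤ 0≤s 0≤s) 0≤d) 0≤δ d≤δ
                                                (ℚ.+-mono-≤ (ℚ.+-mono-≤ s≤B s≤B) d≤1)) ⟩
    s ℚ.* s ℚ.+ δ ℚ.* ((B ℚ.+ B) ℚ.+ 1ℚ)  ∎
    where
    open ℚ.≤-Reasoning
    expand : ∀ s d → (s ℚ.+ d) ℚ.* (s ℚ.+ d) ≡ s ℚ.* s ℚ.+ d ℚ.* ((s ℚ.+ s) ℚ.+ d)
    expand = solve 2 (λ s d → (s :+ d) :* (s :+ d) := s :* s :+ d :* ((s :+ s) :+ d)) refl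
      where open +-*-Solver

  ≤-+ : ∀ {p q ε} → 0ℚ ℚ.< ε → p ℚ.≤ q → p ℚ.≤ q ℚ.+ ε
  ≤-+ {p} {q} {ε} 0<ε p≤q = subst (ℚ._≤ q ℚ.+ ε) (ℚ.+-identityʳ p) (ℚ.+-mono-≤ p≤q (ℚ.<⇒≤ 0<ε))

√-square : ∀ n → √ n * √ n ≈ fromℕ n
√-square n ε 0<ε =
  let B , 0<B , M , b = bound (√ n)
      δ , 0<δ , δ*≡ε  = divide ε ((B ℚ.+ B) ℚ.+ 1ℚ) 0<ε
                          (ℚ.+-mono-< (ℚ.+-mono-< 0<B 0<B) (ℚ.positive⁻¹ 1ℚ))
      N , h           = 1/suc-vanishes δ 0<δ
  in M ℕ.⊔ N , λ j p →
  let 0≤s = frac-≤ 0 0 (√num n j) j z≤n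
  in ∣-∣≤ (√seq n j ℚ.* √seq n j) (+ n ℚ./ 1) ε
    (≤-+ 0<ε (√seq-lower n j))
    (subst (λ e → + n ℚ./ 1 ℚ.≤ √seq n j ℚ.* √seq n j ℚ.+ e) δ*≡ε
      (expand-≤ 0≤s (frac-≤ 0 0 1 j z≤n) (ℚ.<⇒≤ 0<δ)
        (subst (ℚ._≤ B) (ℚ.0≤p⇒∣p∣≡p 0≤s) (b j (⊔≤ˡ M N p)))
        (frac-≤ 1 j 1 0 (s≤s z≤n))
        (h j (⊔≤ʳ M N p))
        (√seq-upper n j)))

------------------------------------------------------------------------
-- Real matrices and eigenvalues

Matrix : ℕ → Set
Matrix n = Fin n → Fin n → ℝ

∑ : ∀ {n} → Vector ℝ n → ℝ
∑ = foldr _+_ 0ℝ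

_*ᵥ_ : ∀ {n} → Matrix n → Vector ℝ n → Vector ℝ n
(A *ᵥ x) i = ∑ λ j → A i j * x j

IsEigenvalue : ∀ {n} → Matrix n → ℝ → Set
IsEigenvalue {n} A μ = Σ (Vector ℝ n) λ x →
  ¬ (∀ i → x i ≈ 0ℝ) × (∀ i → (A *ᵥ x) i ≈ μ * x i)

IsLargestEigenvalue : ∀ {n} → Matrix n → ℝ → Set
IsLargestEigenvalue A ρ = IsEigenvalue A ρ × (∀ μ → IsEigenvalue A μ → μ ≤ ρ)

------------------------------------------------------------------------
-- Finite simple undirected graphs

record Graph (n : ℕ) : Set where
  field
    adj    : Fin n → Fin n → Bool
    symm   : ∀ u v → adj u v ≡ adj v u
    irrefl : ∀ u → adj u u ≡ false

open Graph public

-- Each edge {u , v} is listed once, as the pair with u < v.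
edges : ∀ {n} → Graph n → List (Fin n × Fin n)
edges {n} G = filter (λ (u , v) → (u Fin.<? v) ×-dec (adj G u v Bool.≟ true))
                     (cartesianProduct (allFin n) (allFin n))

edgeCount : ∀ {n} → Graph n → ℕ
edgeCount G = length (edges G)

adjacencyMatrix : ∀ {n} → Graph n → Matrix n
adjacencyMatrix G u v = if adj G u v then 1ℝ else 0ℝ

-- The adjacency matrix is real symmetric, so all its eigenvalues are real and
-- the largest one is the maximum over real eigenvalues.
IsSpectralRadius : ∀ {n} → Graph n → ℝ → Set
IsSpectralRadius G ρ = IsLargestEigenvalue (adjacencyMatrix G) ρ

-- H is a (not necessarily induced) subgraph of G, up to isomorphism.
_⊑_ : ∀ {h n} → Graph h → Graph n → Set
_⊑_ {h} {n} H G = Σ (Fin h → Fin n) λ f → Injective _≡_ _≡_ f ×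
  (∀ u v → adj H u v ≡ true → adj G (f u) (f v) ≡ true)

K₁,_ : ∀ t → Graph (suc t)
adj (K₁, t) zero    (suc _) = true
adj (K₁, t) (suc _) zero    = true
adj (K₁, t) zero    zero    = false
adj (K₁, t) (suc _) (suc _) = false
symm (K₁, t) zero    zero    = refl
symm (K₁, t) zero    (suc _) = refl
symm (K₁, t) (suc _) zero    = refl
symm (K₁, t) (suc _) (suc _) = refl
irrefl (K₁, t) zero    = refl
irrefl (K₁, t) (suc _) = refl

C₄ : Graph 4
adj C₄ u v = does (suc (toℕ u) ℕ.% 4 ℕ.≟ toℕ v) ∨ does (suc (toℕ v) ℕ.% 4 ℕ.≟ toℕ u)
symm C₄ u v = ∨-comm (does (suc (toℕ u) ℕ.% 4 ℕ.≟ toℕ v)) _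
irrefl C₄ zero                   = refl
irrefl C₄ (suc zero)             = refl
irrefl C₄ (suc (suc zero))       = refl
irrefl C₄ (suc (suc (suc zero))) = refl

{-# OPTIONS --safe #-}

-- Suppose G has no C₄ and every degree is at most t - 1, where t = m - k.  Take a vertex u
-- maximising y = |x| for an eigenvector x of ρ ≥ √t, put M = y(u), d = deg u, and let c(j) be the
-- number of common neighbours of u and j, so that c(j) ≤ 1 for j ≠ u.  With Z = Σ_{j≠u} c(j) y(j),
-- expanding A²y at u gives ρ² M ≤ d M + Z.  Expanding ρ Z once more, the neighbours of u
-- contribute at most Z + M Σ_{j~u} c(j) and the remaining vertices at most M Σ deg(j); since
-- c(j) + 1 ≤ deg(j) for j ~ u, the handshake lemma bounds the total by Z + 2(m - d) M.
-- Hence (ρ - 1)(ρ² - d) ≤ 2(m - d), which is impossible for d < t and ρ² ≥ t > (2k + 3)².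
-- As reals are Cauchy sequences, all this is done at one rational stage, with an error η and a
-- fixed rational Q slightly below √t in place of ρ; it shows that x vanishes in the limit.
module Submission where

open import Algebra.Bundles using (CommutativeRing)
open import Data.Bool.Base using (Bool; true; false; _∧_; if_then_else_)
open import Data.Bool.Properties using (_≟_)
open import Data.Fin.Base using (Fin; zero; suc; inject≤)
open import Data.Fin.Patterns using (0F; 1F; 2F; 3F)
import Data.Fin.Properties as Fin
import Data.Integer.Base as ℤ
import Data.Integer.Properties as ℤ
open import Data.List.Base using (List; length; filter; map; tabulate; allFin; cartesianProduct; lookup; _++_)
open import Data.List.Membership.Propositional.Properties using (∈-lookup; ∈-filter⁻)
open import Data.List.Properties using (filter-++; length-++; map-tabulate)
import Data.List.Relation.Unary.All as All
open import Data.List.Relation.Unary.AllPairs using (_∷_)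
open import Data.List.Relation.Unary.Unique.Propositional using (Unique)
open import Data.List.Relation.Unary.Unique.Propositional.Properties using (allFin⁺; filter⁺)
open import Data.Nat.Base as ℕ using (ℕ; zero; suc; _⊔_; _∸_)
import Data.Nat.Properties as ℕ
import Data.Nat.Tactic.RingSolver as ℕ-Ring
open import Data.Product.Base using (∃; _×_; _,_; proj₁; proj₂)
open import Data.Rational.Base using (ℚ; 0ℚ; 1ℚ; _+_; _*_; _-_; -_; _≤_; _<_; _/_; 1/_; ∣_∣; toℚᵘ; NonZero; Positive; positive; nonNegative)
import Data.Rational.Properties as ℚ
open import Data.Rational.Solver using (module +-*-Solver)
open import Data.Rational.Unnormalised.Base using (mkℚᵘ; *≡*)
import Data.Rational.Unnormalised.Base as ℚᵘ
import Data.Rational.Unnormalised.Properties as ℚᵘ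
open import Data.Sum.Base as Sum using (_⊎_; inj₁; inj₂)
open import Function.Base using (_∘_; id)
open import Level using (0ℓ)
open import Relation.Binary.Definitions using (tri<; tri≈; tri>)
open import Relation.Binary.PropositionalEquality using (_≡_; _≢_; refl; sym; trans; cong; cong₂; subst; subst₂; module ≡-Reasoning)
open import Relation.Nullary using (¬_; Dec; yes; no; does; contradiction)
open import Relation.Nullary.Decidable using (¬?; _×-dec_; dec-true; decidable-stable)
open import Relation.Unary using (Pred; Decidable)
open import Defs hiding (_+_; _*_; _≤_)

open import Algebra.Properties.Semiring.Sum (CommutativeRing.semiring ℚ.+-*-commutativeRing)
  using (sum; sum-cong-≗; ∑-distrib-+; ∑-comm; *-distribˡ-sum; *-distribʳ-sum; sum-replicate-zero)
open +-*-Solver using (solve; _:+_; _:*_; _:-_; :-_; _:=_; con)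

-- Rational arithmetic

0≤1 : 0ℚ ≤ 1ℚ
0≤1 = ℚ.nonNegative⁻¹ 1ℚ

-- Most inequalities below are certified by writing the difference of the two sides as a
-- combination z of nonnegative terms.
≤-by : ∀ {p q} z → 0ℚ ≤ z → p + z ≡ q → p ≤ q
≤-by {p} z 0≤z eq = ℚ.≤-trans (ℚ.≤-reflexive (sym (ℚ.+-identityʳ p)))
  (subst (p + 0ℚ ≤_) eq (ℚ.+-monoʳ-≤ p 0≤z))

0≤diff : ∀ {p q} → p ≤ q → 0ℚ ≤ q - p
0≤diff {p} {q} p≤q = subst (_≤ q - p) (ℚ.+-inverseʳ p) (ℚ.+-monoˡ-≤ (- p) p≤q)

infixl 6 _⊕_
infixl 7 _⊗_

_⊕_ : ∀ {p q} → 0ℚ ≤ p → 0ℚ ≤ q → 0ℚ ≤ p + q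
0≤p ⊕ 0≤q = ℚ.+-mono-≤ 0≤p 0≤q

_⊗_ : ∀ {p q} → 0ℚ ≤ p → 0ℚ ≤ q → 0ℚ ≤ p * q
_⊗_ {p} {q} 0≤p 0≤q = subst (_≤ p * q) (ℚ.*-zeroʳ p)
  (ℚ.*-monoˡ-≤-nonNeg p {{nonNegative 0≤p}} 0≤q)

0≤square : ∀ p → 0ℚ ≤ p * p
0≤square p = subst (0ℚ ≤_) eq (ℚ.0≤∣p∣ p ⊗ ℚ.0≤∣p∣ p)
  where
  eq : ∣ p ∣ * ∣ p ∣ ≡ p * p
  eq with ℚ.∣p∣≡p∨∣p∣≡-p p
  ... | inj₁ e = cong (λ q → q * q) e
  ... | inj₂ e = trans (cong (λ q → q * q) e) (solve 1 (λ p → :- p :* :- p := p :* p) refl p)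

0<* : ∀ {p q} → 0ℚ < p → 0ℚ < q → 0ℚ < p * q
0<* {p} {q} 0<p 0<q = ℚ.positive⁻¹ (p * q) {{ℚ.pos*pos⇒pos p {{positive 0<p}} q {{positive 0<q}}}}

square-cancel-≤ : ∀ {p q} → 0ℚ ≤ p → 0ℚ ≤ q → p * p ≤ q * q → p ≤ q
square-cancel-≤ {p} {q} 0≤p 0≤q p²≤q² with q ℚ.<? p
... | no q≮p = ℚ.≮⇒≥ q≮p
... | yes q<p = contradiction (ℚ.≤-<-trans p²≤q² (ℚ.≤-<-trans
  (ℚ.*-monoʳ-≤-nonNeg q {{nonNegative 0≤q}} (ℚ.<⇒≤ q<p))
  (ℚ.*-monoʳ-<-pos p {{positive (ℚ.≤-<-trans 0≤q q<p)}} q<p))) (ℚ.<-irrefl refl)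

quotient : ∀ p q → 0ℚ < p → 0ℚ < q → ∃ λ r → 0ℚ < r × r * q ≡ p
quotient p q 0<p 0<q = p * 1/ q , 0<* 0<p (ℚ.positive⁻¹ (1/ q) {{ℚ.1/pos⇒pos q}}) ,
  trans (ℚ.*-assoc p (1/ q) q) (trans (cong (p *_) (ℚ.*-inverseˡ q)) (ℚ.*-identityʳ p))
  where instance
    q>0 : Positive q
    q>0 = positive 0<q
    q≢0 : NonZero q
    q≢0 = ℚ.pos⇒nonZero q

p≤∣p∣ : ∀ p → p ≤ ∣ p ∣
p≤∣p∣ p with ℚ.∣p∣≡p∨∣p∣≡-p p
... | inj₁ e = ℚ.≤-reflexive (sym e)
... | inj₂ e = ≤-by (∣ p ∣ + ∣ p ∣) (ℚ.0≤∣p∣ p ⊕ ℚ.0≤∣p∣ p)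
  (trans (cong (λ q → p + (q + q)) e)
    (trans (solve 1 (λ p → p :+ (:- p :+ :- p) := :- p) refl p) (sym e)))

∣p-q∣≤⇒p≤q+ : ∀ p q {ε} → ∣ p - q ∣ ≤ ε → p ≤ q + ε
∣p-q∣≤⇒p≤q+ p q {ε} h = ≤-by (ε - (p - q)) (0≤diff (ℚ.≤-trans (p≤∣p∣ (p - q)) h))
  (solve 3 (λ p q ε → p :+ (ε :- (p :- q)) := q :+ ε) refl p q ε)

∣p-q∣≤⇒q≤p+ : ∀ p q {ε} → ∣ p - q ∣ ≤ ε → q ≤ p + ε
∣p-q∣≤⇒q≤p+ p q {ε} h = ∣p-q∣≤⇒p≤q+ q p (subst (_≤ ε)
  (trans (sym (ℚ.∣-p∣≡∣p∣ (p - q))) (cong ∣_∣ (solve 2 (λ p q → :- (p :- q) := q :- p) refl p q))) h)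

∣p-q∣≤⇒∣q∣≤∣p∣+ : ∀ p q {ε} → ∣ p - q ∣ ≤ ε → ∣ q ∣ ≤ ∣ p ∣ + ε
∣p-q∣≤⇒∣q∣≤∣p∣+ p q {ε} h = ℚ.≤-trans
  (subst (λ r → ∣ r ∣ ≤ ∣ p ∣ + ∣ p - q ∣) (solve 2 (λ p q → p :- (p :- q) := q) refl p q) (ℚ.∣p-q∣≤∣p∣+∣q∣ p (p - q)))
  (ℚ.+-monoʳ-≤ ∣ p ∣ h)

-- Natural numbers embedded in the rationals

ι : ℕ → ℚ
ι n = ℤ.+ n / 1

ι-ᵘ : ∀ n → toℚᵘ (ι n) ℚᵘ.≃ mkℚᵘ (ℤ.+ n) 0
ι-ᵘ n = ℚ.toℚᵘ-fromℚᵘ (mkℚᵘ (ℤ.+ n) 0)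

ι-+ : ∀ m n → ι (m ℕ.+ n) ≡ ι m + ι n
ι-+ m n = ℚ.toℚᵘ-injective (begin
  toℚᵘ (ι (m ℕ.+ n))                   ≈⟨ ι-ᵘ (m ℕ.+ n) ⟩
  mkℚᵘ (ℤ.+ (m ℕ.+ n)) 0               ≈⟨ *≡* (cong (ℤ._* ℤ.+ 1) (cong₂ ℤ._+_ (sym (ℤ.*-identityʳ (ℤ.+ m))) (sym (ℤ.*-identityʳ (ℤ.+ n))))) ⟩
  mkℚᵘ (ℤ.+ m) 0 ℚᵘ.+ mkℚᵘ (ℤ.+ n) 0   ≈⟨ ℚᵘ.+-cong (ι-ᵘ m) (ι-ᵘ n) ⟨
  toℚᵘ (ι m) ℚᵘ.+ toℚᵘ (ι n)           ≈⟨ ℚ.toℚᵘ-homo-+ (ι m) (ι n) ⟨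
  toℚᵘ (ι m + ι n)                     ∎)
  where open ℚᵘ.≃-Reasoning

ι-* : ∀ m n → ι (m ℕ.* n) ≡ ι m * ι n
ι-* m n = ℚ.toℚᵘ-injective (begin
  toℚᵘ (ι (m ℕ.* n))                   ≈⟨ ι-ᵘ (m ℕ.* n) ⟩
  mkℚᵘ (ℤ.+ (m ℕ.* n)) 0               ≈⟨ *≡* (cong (ℤ._* ℤ.+ 1) (ℤ.pos-* m n)) ⟩
  mkℚᵘ (ℤ.+ m) 0 ℚᵘ.* mkℚᵘ (ℤ.+ n) 0   ≈⟨ ℚᵘ.*-cong (ι-ᵘ m) (ι-ᵘ n) ⟨
  toℚᵘ (ι m) ℚᵘ.* toℚᵘ (ι n)           ≈⟨ ℚ.toℚᵘ-homo-* (ι m) (ι n) ⟨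
  toℚᵘ (ι m * ι n)                     ∎)
  where open ℚᵘ.≃-Reasoning

0≤frac : ∀ n d .{{_ : ℕ.NonZero d}} → 0ℚ ≤ ℤ.+ n / d
0≤frac n d = ℚ.nonNegative⁻¹ (ℤ.+ n / d) {{ℚ.normalize-nonNeg n d}}

ι-mono-≤ : ∀ {m n} → m ℕ.≤ n → ι m ≤ ι n
ι-mono-≤ {m} {n} m≤n = ≤-by (ι (n ∸ m)) (0≤frac (n ∸ m) 1)
  (trans (sym (ι-+ m (n ∸ m))) (cong ι (ℕ.m+[n∸m]≡n m≤n)))

-- Finite sums, maxima, indicators and counting

sum-mono-≤ : ∀ {n} {f g : Fin n → ℚ} → (∀ i → f i ≤ g i) → sum f ≤ sum g
sum-mono-≤ {zero}  h = ℚ.≤-refl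
sum-mono-≤ {suc n} h = ℚ.+-mono-≤ (h zero) (sum-mono-≤ (h ∘ suc))

0≤sum : ∀ {n} {f : Fin n → ℚ} → (∀ i → 0ℚ ≤ f i) → 0ℚ ≤ sum f
0≤sum {zero}  h = ℚ.≤-refl
0≤sum {suc n} h = h zero ⊕ 0≤sum (h ∘ suc)

∣sum∣≤sum∣∣ : ∀ {n} (f : Fin n → ℚ) → ∣ sum f ∣ ≤ sum (∣_∣ ∘ f)
∣sum∣≤sum∣∣ {zero}  f = ℚ.≤-refl
∣sum∣≤sum∣∣ {suc n} f = ℚ.≤-trans (ℚ.∣p+q∣≤∣p∣+∣q∣ (f zero) (sum (f ∘ suc)))
  (ℚ.+-monoʳ-≤ ∣ f zero ∣ (∣sum∣≤sum∣∣ (f ∘ suc)))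

-- The second argument rules out an empty index set.
argmax : ∀ {n} (f : Fin n → ℚ) → Fin n → ∃ λ u → ∀ i → f i ≤ f u
argmax {suc zero}    f _ = zero , λ where zero → ℚ.≤-refl
argmax {suc (suc n)} f _ with argmax (f ∘ suc) zero
... | u , h with ℚ.≤-total (f zero) (f (suc u))
...   | inj₁ le = suc u , λ where
  zero    → le
  (suc i) → h i
...   | inj₂ ge = zero , λ where
  zero    → ℚ.≤-refl
  (suc i) → ℚ.≤-trans (h i) ge

χ : Bool → ℚ
χ true  = 1ℚ
χ false = 0ℚ

0≤χ : ∀ b → 0ℚ ≤ χ b
0≤χ true  = 0≤1
0≤χ false = ℚ.≤-refl

χ≤1 : ∀ b → χ b ≤ 1ℚ
χ≤1 true  = ℚ.≤-refl
χ≤1 false = 0≤1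

χ≤ : ∀ b {p} → 0ℚ ≤ p → (b ≡ true → 1ℚ ≤ p) → χ b ≤ p
χ≤ true  _   h = h refl
χ≤ false 0≤p _ = 0≤p

χ-∧ : ∀ a b → χ a * χ b ≡ χ (a ∧ b)
χ-∧ true  b = ℚ.*-identityˡ (χ b)
χ-∧ false b = ℚ.*-zeroˡ (χ b)

χ-idem : ∀ b → χ b * χ b ≡ χ b
χ-idem true  = refl
χ-idem false = refl

sum-χ≤1 : ∀ {n} (b : Fin n → Bool) → (∀ v w → b v ≡ true → b w ≡ true → v ≡ w) → sum (χ ∘ b) ≤ 1ℚ
sum-χ≤1 {zero}  b h = 0≤1
sum-χ≤1 {suc n} b h with b zero in b₀
... | false = ℚ.≤-trans (ℚ.≤-reflexive (ℚ.+-identityˡ _))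
  (sum-χ≤1 (b ∘ suc) λ v w p q → Fin.suc-injective (h (suc v) (suc w) p q))
... | true = ℚ.≤-reflexive (trans (cong (1ℚ +_) (trans (sum-cong-≗ rest) (sum-replicate-zero n))) (ℚ.+-identityʳ 1ℚ))
  where
  rest : ∀ v → χ (b (suc v)) ≡ 0ℚ
  rest v with b (suc v) in bᵥ
  ... | false = refl
  ... | true  = contradiction (h zero (suc v) b₀ bᵥ) Fin.0≢1+n

δ : ∀ {n} → Fin n → Fin n → ℚ
δ u j = χ (does (u Fin.≟ j))

sum-δ : ∀ {n} (u : Fin n) → sum (δ u) ≡ 1ℚ
sum-δ {suc n} zero    = trans (cong (1ℚ +_) (sum-replicate-zero n)) (ℚ.+-identityʳ 1ℚ)
sum-δ {suc n} (suc u) = trans (ℚ.+-identityˡ _) (sum-δ u)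

-- Lengths of filtered lists become sums of indicators, the form in which degrees and edge counts
-- enter the rational estimates.
ι-length-filter : ∀ {A : Set} {P : Pred A 0ℓ} (P? : Decidable P) {n} (f : Fin n → A) →
                  ι (length (filter P? (tabulate f))) ≡ sum (λ i → χ (does (P? (f i))))
ι-length-filter P? {zero}  f = refl
ι-length-filter P? {suc n} f with does (P? (f zero))
... | false = trans (ι-length-filter P? (f ∘ suc)) (sym (ℚ.+-identityˡ _))
... | true  = trans (ι-+ 1 (length (filter P? (tabulate (f ∘ suc))))) (cong (1ℚ +_) (ι-length-filter P? (f ∘ suc)))

ι-length-filter-× : ∀ {A B : Set} {P : Pred (A × B) 0ℓ} (P? : Decidable P) {m n} (f : Fin m → A) (g : Fin n → B) →
  ι (length (filter P? (cartesianProduct (tabulate f) (tabulate g)))) ≡ sum (λ i → sum (λ j → χ (does (P? (f i , g j)))))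
ι-length-filter-× P? {zero}  f g = refl
ι-length-filter-× P? {suc m} f g = begin
  ι (length (filter P? (row ++ rest)))
    ≡⟨ cong (ι ∘ length) (filter-++ P? row rest) ⟩
  ι (length (filter P? row ++ filter P? rest))
    ≡⟨ cong ι (length-++ (filter P? row)) ⟩
  ι (length (filter P? row) ℕ.+ length (filter P? rest))
    ≡⟨ ι-+ (length (filter P? row)) (length (filter P? rest)) ⟩
  ι (length (filter P? row)) + ι (length (filter P? rest))
    ≡⟨ cong₂ _+_ (trans (cong (ι ∘ length ∘ filter P?) (map-tabulate g (f zero ,_)))
                        (ι-length-filter P? (λ j → f zero , g j)))
                 (ι-length-filter-× P? (f ∘ suc) g) ⟩
  sum (λ i → sum (λ j → χ (does (P? (f i , g j))))) ∎
  where
  open ≡-Reasoning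
  row  = map (f zero ,_) (tabulate g)
  rest = cartesianProduct (tabulate (f ∘ suc)) (tabulate g)

-- Degrees, codegrees and the extremal estimate

module _ {n} (G : Graph n) where

  a : Fin n → Fin n → ℚ
  a i j = χ (adj G i j)

  0≤a : ∀ i j → 0ℚ ≤ a i j
  0≤a i j = 0≤χ (adj G i j)

  a-sym : ∀ i j → a i j ≡ a j i
  a-sym i j = cong χ (symm G i j)

  deg : Fin n → ℚ
  deg i = sum (a i)

  codeg : Fin n → Fin n → ℚ
  codeg i j = sum (λ v → a i v * a v j)

  0≤deg : ∀ i → 0ℚ ≤ deg i
  0≤deg i = 0≤sum (0≤a i)

  0≤codeg : ∀ i j → 0ℚ ≤ codeg i j
  0≤codeg i j = 0≤sum (λ v → 0≤a i v ⊗ 0≤a v j)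

  codeg-diag : ∀ u → codeg u u ≡ deg u
  codeg-diag u = sum-cong-≗ λ v → trans (cong (a u v *_) (a-sym v u)) (χ-idem (adj G u v))

  -- Common neighbours of `u` and `j` are neighbours of `j` other than `u`. The added 1 fills the
  -- slot v = u, where `a u u` is 0 but `a j u` is 1.
  codeg+1≤deg : ∀ u j → adj G u j ≡ true → codeg u j + 1ℚ ≤ deg j
  codeg+1≤deg u j uj = ℚ.≤-trans
    (ℚ.≤-reflexive (trans (cong (codeg u j +_) (sym (sum-δ u))) (sym (∑-distrib-+ _ (δ u)))))
    (sum-mono-≤ pointwise)
    where
    pointwise : ∀ v → a u v * a v j + δ u v ≤ a j v
    pointwise v with u Fin.≟ v
    ... | yes refl rewrite irrefl G u | trans (symm G j u) uj | uj = ℚ.≤-refl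
    ... | no _ rewrite symm G j v with adj G u v
    ...   | true  = ℚ.≤-reflexive (trans (ℚ.+-identityʳ _) (ℚ.*-identityˡ _))
    ...   | false = ℚ.≤-trans (ℚ.≤-reflexive (trans (ℚ.+-identityʳ _) (ℚ.*-zeroˡ (a v j)))) (0≤a v j)

  -- An adjacent pair is listed in `edges` in one of its two orders, so each `a i j` is at most
  -- `L i j + L j i`; exchanging one double sum gives twice the edge count.
  handshake : sum deg ≤ ι (edgeCount G) + ι (edgeCount G)
  handshake = ℚ.≤-trans (sum-mono-≤ λ i → sum-mono-≤ (pointwise i)) (ℚ.≤-reflexive (begin
    sum (λ i → sum (λ j → L i j + L j i))
      ≡⟨ sum-cong-≗ (λ i → ∑-distrib-+ (L i) (λ j → L j i)) ⟩
    sum (λ i → sum (L i) + sum (λ j → L j i))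
      ≡⟨ ∑-distrib-+ (λ i → sum (L i)) (λ i → sum (λ j → L j i)) ⟩
    sum (λ i → sum (L i)) + sum (λ i → sum (λ j → L j i))
      ≡⟨ cong (sum (λ i → sum (L i)) +_) (∑-comm (λ i j → L j i)) ⟩
    sum (λ i → sum (L i)) + sum (λ i → sum (L i))
      ≡⟨ cong (λ s → s + s) (ι-length-filter-× edge? id id) ⟨
    ι (edgeCount G) + ι (edgeCount G) ∎))
    where
    open ≡-Reasoning
    edge? = λ ((u , v) : Fin n × Fin n) → (u Fin.<? v) ×-dec (adj G u v ≟ true)
    L : Fin n → Fin n → ℚ
    L i j = χ (does (edge? (i , j)))
    0≤L : ∀ i j → 0ℚ ≤ L i j
    0≤L i j = 0≤χ (does (edge? (i , j)))
    pointwise : ∀ i j → a i j ≤ L i j + L j i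
    pointwise i j = χ≤ (adj G i j) (0≤L i j ⊕ 0≤L j i) listed
      where
      listed : adj G i j ≡ true → 1ℚ ≤ L i j + L j i
      listed ij with Fin.<-cmp i j
      ... | tri< i<j _ _ = ℚ.+-mono-≤
        (ℚ.≤-reflexive (sym (cong χ (dec-true (edge? (i , j)) (i<j , ij))))) (0≤L j i)
      ... | tri≈ _ refl _ = contradiction (trans (sym ij) (irrefl G i)) λ ()
      ... | tri> _ _ j<i = ℚ.+-mono-≤ (0≤L i j)
        (ℚ.≤-reflexive (sym (cong χ (dec-true (edge? (j , i)) (j<i , trans (symm G j i) ij)))))

  -- The form of C₄-freeness used for counting: two different common neighbours of distinct `u` and
  -- `j` would close a 4-cycle.
  AtMostOneCommonNeighbour : Set
  AtMostOneCommonNeighbour = ∀ u j → u ≢ j → ∀ v w → adj G u v ≡ true → adj G v j ≡ true →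
    adj G u w ≡ true → adj G w j ≡ true → v ≡ w

  codeg≤1 : AtMostOneCommonNeighbour → ∀ {u j} → u ≢ j → codeg u j ≤ 1ℚ
  codeg≤1 h {u} {j} u≢j = ℚ.≤-trans
    (ℚ.≤-reflexive (sum-cong-≗ λ v → χ-∧ (adj G u v) (adj G v j)))
    (sum-χ≤1 (λ v → adj G u v ∧ adj G v j) λ v w p q →
      h u j u≢j v w (∧-trueˡ p) (∧-trueʳ {adj G u v} p) (∧-trueˡ q) (∧-trueʳ {adj G u w} q))
    where
    ∧-trueˡ : ∀ {x y} → x ∧ y ≡ true → x ≡ true
    ∧-trueˡ {true} _ = refl
    ∧-trueʳ : ∀ {x y} → x ∧ y ≡ true → y ≡ true
    ∧-trueʳ {true} e = e

  -- `codeg` is the entry of A², and the two sides are row `u` of A(Az) and of A²z.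
  sum-a-sum-a : ∀ u (z : Fin n → ℚ) → sum (λ v → a u v * sum (λ j → a v j * z j)) ≡ sum (λ j → codeg u j * z j)
  sum-a-sum-a u z = begin
    sum (λ v → a u v * sum (λ j → a v j * z j))
      ≡⟨ sum-cong-≗ (λ v → *-distribˡ-sum (a u v) (λ j → a v j * z j)) ⟩
    sum (λ v → sum (λ j → a u v * (a v j * z j)))
      ≡⟨ ∑-comm (λ v j → a u v * (a v j * z j)) ⟩
    sum (λ j → sum (λ v → a u v * (a v j * z j)))
      ≡⟨ sum-cong-≗ (λ j → trans (sum-cong-≗ (λ v → sym (ℚ.*-assoc (a u v) (a v j) (z j))))
                                 (sym (*-distribʳ-sum (z j) (λ v → a u v * a v j)))) ⟩
    sum (λ j → codeg u j * z j) ∎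
    where open ≡-Reasoning

  -- `Qy≤` is what survives of the eigenvalue equation for y = |x| at one rational stage, with `Q`
  -- in place of the eigenvalue and error `η`.
  module Extremal
    (amo : AtMostOneCommonNeighbour) (y : Fin n → ℚ) (0≤y : ∀ i → 0ℚ ≤ y i)
    (u : Fin n) (y≤ : ∀ i → y i ≤ y u)
    (Q η : ℚ) (0≤Q : 0ℚ ≤ Q) (0≤η : 0ℚ ≤ η)
    (Qy≤ : ∀ i → Q * y i ≤ sum (λ j → a i j * y j) + η) where

    M d D N : ℚ
    M = y u
    d = deg u
    D = sum deg
    N = sum {n} (λ _ → 1ℚ)

    -- `z` is `y` with its entry at `u` erased. This keeps the diagonal entry `codeg u u = d` out of
    -- `Z`, whose remaining coefficients are at most 1.
    g z : Fin n → ℚ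
    g i = sum (λ j → a i j * y j)
    z j = (1ℚ - δ u j) * y j

    Z : ℚ
    Z = sum (λ j → codeg u j * z j)

    0≤z : ∀ j → 0ℚ ≤ z j
    0≤z j = 0≤diff (χ≤1 (does (u Fin.≟ j))) ⊗ 0≤y j

    -- `Qy≤` is used at `u` and then at each neighbour of `u`, giving row `u` of A²y, from which the
    -- diagonal term is split off. The first use costs `Q * η`, the others one `η` per neighbour.
    first-step : Q * (Q * M) ≤ (d * M + Z) + (d + Q) * η
    first-step = begin
      Q * (Q * M)
        ≤⟨ ℚ.*-monoˡ-≤-nonNeg Q {{nonNegative 0≤Q}} (Qy≤ u) ⟩
      Q * (g u + η)
        ≡⟨ ℚ.*-distribˡ-+ Q (g u) η ⟩
      Q * g u + Q * η
        ≡⟨ cong (_+ Q * η) (*-distribˡ-sum Q (λ v → a u v * y v)) ⟩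
      sum (λ v → Q * (a u v * y v)) + Q * η
        ≤⟨ ℚ.+-monoˡ-≤ (Q * η) (sum-mono-≤ λ v → scaled (a u v) (y v) (g v) (0≤a u v) (Qy≤ v)) ⟩
      sum (λ v → a u v * g v + a u v * η) + Q * η
        ≡⟨ cong (_+ Q * η) (∑-distrib-+ (λ v → a u v * g v) (λ v → a u v * η)) ⟩
      sum (λ v → a u v * g v) + sum (λ v → a u v * η) + Q * η
        ≡⟨ cong₂ (λ s s′ → s + s′ + Q * η) (trans (sum-a-sum-a u y) split) (sym (*-distribʳ-sum η (a u))) ⟩
      (d * M + Z) + d * η + Q * η
        ≡⟨ solve 4 (λ s d Q η → s :+ d :* η :+ Q :* η := s :+ (d :+ Q) :* η) refl (d * M + Z) d Q η ⟩
      (d * M + Z) + (d + Q) * η ∎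
      where
      open ℚ.≤-Reasoning
      scaled : ∀ c y g → 0ℚ ≤ c → Q * y ≤ g + η → Q * (c * y) ≤ c * g + c * η
      scaled c y g 0≤c h = ≤-by (c * (g + η - Q * y)) (0≤c ⊗ 0≤diff h)
        (solve 5 (λ Q c y g η → Q :* (c :* y) :+ c :* (g :+ η :- Q :* y) := c :* g :+ c :* η) refl Q c y g η)
      pointwise : ∀ j → codeg u j * y j ≡ δ u j * (d * M) + codeg u j * z j
      pointwise j with u Fin.≟ j
      ... | yes refl = trans (cong (_* M) (codeg-diag u))
        (solve 3 (λ p c y → p := con 1ℚ :* p :+ c :* ((con 1ℚ :- con 1ℚ) :* y)) refl (d * M) (codeg u u) M)
      ... | no _ = solve 3 (λ p c y → c :* y := con 0ℚ :* p :+ c :* ((con 1ℚ :- con 0ℚ) :* y)) refl (d * M) (codeg u j) (y j)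
      split : sum (λ j → codeg u j * y j) ≡ d * M + Z
      split = trans (sum-cong-≗ pointwise) (trans (∑-distrib-+ (λ j → δ u j * (d * M)) (λ j → codeg u j * z j))
        (cong (_+ Z) (trans (sym (*-distribʳ-sum (d * M) (δ u))) (trans (cong (_* (d * M)) (sum-δ u)) (ℚ.*-identityˡ (d * M))))))

    g≤deg*M : ∀ j → g j ≤ deg j * M
    g≤deg*M j = ℚ.≤-trans (sum-mono-≤ λ i → ℚ.*-monoˡ-≤-nonNeg (a j i) {{nonNegative (0≤a j i)}} (y≤ i))
      (ℚ.≤-reflexive (sym (*-distribʳ-sum M (a j))))

    -- The part of `g` not coming from `u`; summed over the neighbours of `u` it reproduces `Z`.
    H : Fin n → ℚ
    H j = sum (λ i → a j i * z i)

    0≤H : ∀ j → 0ℚ ≤ H j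
    0≤H j = 0≤sum λ i → 0≤a j i ⊗ 0≤z i

    g≤M+H : ∀ j → g j ≤ M + H j
    g≤M+H j = ℚ.≤-trans (sum-mono-≤ pointwise) (ℚ.≤-reflexive
      (trans (∑-distrib-+ (λ i → δ u i * M) (λ i → a j i * z i))
        (cong (_+ H j) (trans (sym (*-distribʳ-sum M (δ u))) (trans (cong (_* M) (sum-δ u)) (ℚ.*-identityˡ M))))))
      where
      pointwise : ∀ i → a j i * y i ≤ δ u i * M + a j i * z i
      pointwise i with u Fin.≟ i
      ... | yes refl = ≤-by ((1ℚ - a j u) * M) (0≤diff (χ≤1 (adj G j u)) ⊗ 0≤y u)
        (solve 2 (λ a y → a :* y :+ (con 1ℚ :- a) :* y := con 1ℚ :* y :+ a :* ((con 1ℚ :- con 1ℚ) :* y)) refl (a j u) M)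
      ... | no _ = ℚ.≤-reflexive
        (solve 3 (λ a y M → a :* y := con 0ℚ :* M :+ a :* ((con 1ℚ :- con 0ℚ) :* y)) refl (a j i) (y i) M)

    -- The bracket is the number of edges at j outside the star of u.
    local : ∀ j → codeg u j * ((1ℚ - δ u j) * g j) ≤ M * (deg j - a u j - δ u j * d) + a u j * H j
    local j with u Fin.≟ j
    ... | yes refl = ≤-by (a u u * H u) (0≤a u u ⊗ 0≤H u) eq
      where
      eq : codeg u u * ((1ℚ - 1ℚ) * g u) + a u u * H u ≡ M * (d - a u u - 1ℚ * d) + a u u * H u
      eq rewrite irrefl G u = solve 5 (λ c g M d H →
        c :* ((con 1ℚ :- con 1ℚ) :* g) :+ con 0ℚ :* H := M :* (d :- con 0ℚ :- con 1ℚ :* d) :+ con 0ℚ :* H)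
        refl (codeg u u) (g u) M d (H u)
    ... | no u≢j with adj G u j in uj
    -- From `g j` ≤ M + H j: the part c * M is at most (deg j - 1) * M by `codeg+1≤deg`, and c ≤ 1
    -- leaves a single `H j`.
    ...   | true = ≤-by (c * (M + H j - g j) + (deg j - (c + 1ℚ)) * M + (1ℚ - c) * H j)
        (0≤codeg u j ⊗ 0≤diff (g≤M+H j) ⊕ 0≤diff (codeg+1≤deg u j uj) ⊗ 0≤y u ⊕ 0≤diff (codeg≤1 amo u≢j) ⊗ 0≤H j)
        (solve 6 (λ c g M H e d →
          c :* ((con 1ℚ :- con 0ℚ) :* g) :+ (c :* (M :+ H :- g) :+ (e :- (c :+ con 1ℚ)) :* M :+ (con 1ℚ :- c) :* H)
          := M :* (e :- con 1ℚ :- con 0ℚ :* d) :+ con 1ℚ :* H) refl c (g j) M (H j) (deg j) d)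
      where c = codeg u j
    -- No edge at `j` meets `u`, so c ≤ 1 and the crude bound deg j * M suffice.
    ...   | false = ≤-by (c * (deg j * M - g j) + (1ℚ - c) * (deg j * M))
        (0≤codeg u j ⊗ 0≤diff (g≤deg*M j) ⊕ 0≤diff (codeg≤1 amo u≢j) ⊗ (0≤deg j ⊗ 0≤y u))
        (solve 6 (λ c g M H e d →
          c :* ((con 1ℚ :- con 0ℚ) :* g) :+ (c :* (e :* M :- g) :+ (con 1ℚ :- c) :* (e :* M))
          := M :* (e :- con 0ℚ :- con 0ℚ :* d) :+ con 0ℚ :* H) refl c (g j) M (H j) (deg j) d)
      where c = codeg u j

    -- Expanding each `z j` by `Qy≤` and summing `local` over `j`, the `H` terms return `Z` and the
    -- brackets add up to D - 2d. Each vertex costs at most one `η`.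
    second-step : Q * Z ≤ Z + M * (D - d - d) + N * η
    second-step = begin
      Q * Z
        ≡⟨ *-distribˡ-sum Q (λ j → codeg u j * z j) ⟩
      sum (λ j → Q * (codeg u j * z j))
        ≤⟨ sum-mono-≤ pointwise ⟩
      sum (λ j → a u j * H j + M * (deg j - a u j - δ u j * d) + 1ℚ * η)
        ≡⟨ ∑-distrib-+ (λ j → a u j * H j + M * (deg j - a u j - δ u j * d)) (λ _ → 1ℚ * η) ⟩
      sum (λ j → a u j * H j + M * (deg j - a u j - δ u j * d)) + sum {n} (λ _ → 1ℚ * η)
        ≡⟨ cong₂ _+_ (∑-distrib-+ (λ j → a u j * H j) (λ j → M * (deg j - a u j - δ u j * d)))
                     (sym (*-distribʳ-sum {n} η (λ _ → 1ℚ))) ⟩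
      sum (λ j → a u j * H j) + sum (λ j → M * (deg j - a u j - δ u j * d)) + N * η
        ≡⟨ cong₂ (λ s s′ → s + s′ + N * η) (sum-a-sum-a u z)
             (trans (sym (*-distribˡ-sum M (λ j → deg j - a u j - δ u j * d))) (cong (M *_) outside)) ⟩
      Z + M * (D - d - d) + N * η ∎
      where
      open ℚ.≤-Reasoning
      sum-neg : ∀ {n} (f : Fin n → ℚ) → sum (λ j → - f j) ≡ - sum f
      sum-neg {zero}  f = refl
      sum-neg {suc n} f = trans (cong (- f zero +_) (sum-neg (f ∘ suc))) (sym (ℚ.neg-distrib-+ (f zero) _))
      outside : sum (λ j → deg j - a u j - δ u j * d) ≡ D - d - d
      outside = trans (∑-distrib-+ (λ j → deg j - a u j) (λ j → - (δ u j * d)))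
        (cong₂ _+_ (trans (∑-distrib-+ deg (λ j → - a u j)) (cong (D +_) (sum-neg (a u))))
          (trans (sum-neg (λ j → δ u j * d))
            (cong -_ (trans (sym (*-distribʳ-sum d (δ u))) (trans (cong (_* d) (sum-δ u)) (ℚ.*-identityˡ d))))))
      cη : ∀ j → codeg u j * ((1ℚ - δ u j) * η) ≤ 1ℚ * η
      cη j with u Fin.≟ j
      ... | yes refl = ≤-by η 0≤η (solve 2 (λ c η → c :* ((con 1ℚ :- con 1ℚ) :* η) :+ η := con 1ℚ :* η) refl (codeg u u) η)
      ... | no u≢j = ≤-by ((1ℚ - codeg u j) * η) (0≤diff (codeg≤1 amo u≢j) ⊗ 0≤η)
        (solve 2 (λ c η → c :* ((con 1ℚ :- con 0ℚ) :* η) :+ (con 1ℚ :- c) :* η := con 1ℚ :* η) refl (codeg u j) η)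
      pointwise : ∀ j → Q * (codeg u j * z j) ≤ a u j * H j + M * (deg j - a u j - δ u j * d) + 1ℚ * η
      pointwise j = begin
        Q * (c * (e * y j))
          ≤⟨ ≤-by (c * (e * (g j + η - Q * y j))) (0≤codeg u j ⊗ (0≤diff (χ≤1 (does (u Fin.≟ j))) ⊗ 0≤diff (Qy≤ j)))
               (solve 6 (λ Q c e y g η → Q :* (c :* (e :* y)) :+ c :* (e :* (g :+ η :- Q :* y))
                 := c :* (e :* g) :+ c :* (e :* η)) refl Q c e (y j) (g j) η) ⟩
        c * (e * g j) + c * (e * η)
          ≤⟨ ℚ.+-mono-≤ (local j) (cη j) ⟩
        M * (deg j - a u j - δ u j * d) + a u j * H j + 1ℚ * η
          ≡⟨ cong (_+ 1ℚ * η) (ℚ.+-comm (M * (deg j - a u j - δ u j * d)) (a u j * H j)) ⟩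
        a u j * H j + M * (deg j - a u j - δ u j * d) + 1ℚ * η ∎
        where
        c = codeg u j
        e = 1ℚ - δ u j

    d≤N : d ≤ N
    d≤N = sum-mono-≤ λ j → χ≤1 (adj G u j)

    -- Adding (Q - 1) times `first-step` to `second-step` cancels `Z`. In the coefficient of `M`,
    -- `d` then occurs as -(Q - 3) d, so Q ≥ 3 allows replacing it by t - 1, and 2k + 2 remains to
    -- be subtracted. In the error, `d` is replaced by `N` to make the bound independent of `u`.
    weighted-maximum-bound : ∀ t k → D ≤ (t + k) + (t + k) → d + 1ℚ ≤ t → 1ℚ + 1ℚ + 1ℚ ≤ Q →
      ((Q - 1ℚ) * (Q * Q - t + 1ℚ) - (k + k + (1ℚ + 1ℚ))) * M ≤ (N + (Q - 1ℚ) * (N + Q)) * η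
    weighted-maximum-bound t k D≤ d<t 3≤Q = ≤-by
      ((Q - 1ℚ) * ((d * M + Z) + (d + Q) * η - Q * (Q * M))
        + (Z + M * (D - d - d) + N * η - Q * Z)
        + ((t + k) + (t + k) - D) * M
        + (Q - (1ℚ + 1ℚ + 1ℚ)) * (t - (d + 1ℚ)) * M
        + (Q - 1ℚ) * (N - d) * η)
      (0≤Q-1 ⊗ 0≤diff first-step ⊕ 0≤diff second-step ⊕ 0≤diff D≤ ⊗ 0≤y u
        ⊕ 0≤diff 3≤Q ⊗ 0≤diff d<t ⊗ 0≤y u ⊕ 0≤Q-1 ⊗ 0≤diff d≤N ⊗ 0≤η)
      (solve 9 (λ Q M Z d η D N t k →
        let o = con 1ℚ in
        ((Q :- o) :* (Q :* Q :- t :+ o) :- (k :+ k :+ (o :+ o))) :* M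
        :+ ((Q :- o) :* ((d :* M :+ Z) :+ (d :+ Q) :* η :- Q :* (Q :* M))
          :+ (Z :+ M :* (D :- d :- d) :+ N :* η :- Q :* Z)
          :+ ((t :+ k) :+ (t :+ k) :- D) :* M
          :+ (Q :- (o :+ o :+ o)) :* (t :- (d :+ o)) :* M
          :+ (Q :- o) :* (N :- d) :* η)
        := (N :+ (Q :- o) :* (N :+ Q)) :* η) refl Q M Z d η D N t k)
      where
      0≤Q-1 : 0ℚ ≤ Q - 1ℚ
      0≤Q-1 = 0≤diff {1ℚ} (ℚ.≤-trans (≤-by {1ℚ} (1ℚ + 1ℚ) (0≤1 ⊕ 0≤1) refl) 3≤Q)

    -- The last hypothesis is the choice of `η` for a given `ε`; its extra 1 keeps the divisor
    -- positive. The positive coefficient of `M` then cancels.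
    maximum-bound : ∀ t k ε → D ≤ (t + k) + (t + k) → d + 1ℚ ≤ t → 1ℚ + 1ℚ + 1ℚ ≤ Q →
      0ℚ < (Q - 1ℚ) * (Q * Q - t + 1ℚ) - (k + k + (1ℚ + 1ℚ)) →
      η * (N + (Q - 1ℚ) * (N + Q) + 1ℚ) ≡ ((Q - 1ℚ) * (Q * Q - t + 1ℚ) - (k + k + (1ℚ + 1ℚ))) * ε →
      M ≤ ε
    maximum-bound t k ε D≤ d<t 3≤Q 0<κ η≡ =
      ℚ.*-cancelˡ-≤-pos ((Q - 1ℚ) * (Q * Q - t + 1ℚ) - (k + k + (1ℚ + 1ℚ))) {{positive 0<κ}}
        (ℚ.≤-trans (weighted-maximum-bound t k D≤ d<t 3≤Q) (ℚ.≤-trans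
          (≤-by η 0≤η (solve 2 (λ K η → K :* η :+ η := η :* (K :+ con 1ℚ)) refl (N + (Q - 1ℚ) * (N + Q)) η))
          (ℚ.≤-reflexive η≡)))

-- Approximating √t from below

-- AM-GM, 2z ≤ z² + 1, bounds the loss in squaring z - 2ε without an upper bound on z.
rational-below-√ : ∀ t ρ δ → 2 ℕ.≤ t → 0ℚ < δ → δ ≤ 1ℚ → ρ ≥ √ t →
  ∃ λ Q → 0ℚ ≤ Q × ι t ≤ Q * Q + δ × Eventually λ n → Q ≤ seq ρ n
rational-below-√ t ρ δ 2≤t 0<δ δ≤1 √t≤ρ =
  let 2≤τ : 1ℚ + 1ℚ ≤ ι t
      2≤τ = ι-mono-≤ 2≤t
      0≤τ = ℚ.≤-trans (0≤1 ⊕ 0≤1) 2≤τ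
      τ   = ι t
      0<K = ℚ.+-mono-≤-< (0≤τ ⊕ 0≤τ) (ℚ.positive⁻¹ (1ℚ + 1ℚ + 1ℚ))
      -- The factor 2τ + 3 is the loss in `square-lemma`: z² may fall short of τ by ε, and 4εz ≤
      -- 2ε(z² + 1) ≤ 2ε(τ + ε + 1), while 4ε² is regained.
      ε , 0<ε , ε*K≡δ = quotient δ (τ + τ + (1ℚ + 1ℚ + 1ℚ)) 0<δ 0<K
      N₀ , square = √-square t ε 0<ε
      N₁ , close  = cauchy (√ t) ε 0<ε
      N₂ , below  = √t≤ρ ε 0<ε
      N   = N₀ ⊔ N₁
      z   = seq (√ t) N
      0≤z = 0≤frac ⌊√ t ℕ.* (suc N ℕ.* suc N) ⌋ (suc N)
      z²≈ = square N (ℕ.m≤m⊔n N₀ N₁)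
      2ε≤1 = 2ε≤1-lemma τ ε (ℚ.<⇒≤ 0<ε) 0≤τ (subst (_≤ 1ℚ) (sym ε*K≡δ) δ≤1)
      1≤z = 1≤z-lemma τ ε z 0≤z 2≤τ (ℚ.<⇒≤ 0<ε) 2ε≤1 (∣p-q∣≤⇒q≤p+ (z * z) τ z²≈)
  -- One ε pays for passing from the fixed term `z` to later terms of `√ t`, the other for the
  -- inequality between `√ t` and `ρ`.
  in z - (ε + ε)
   , 0≤diff (ℚ.≤-trans 2ε≤1 1≤z)
   , subst (λ δ → τ ≤ (z - (ε + ε)) * (z - (ε + ε)) + δ) ε*K≡δ
       (square-lemma τ ε z (ℚ.<⇒≤ 0<ε) (∣p-q∣≤⇒q≤p+ (z * z) τ z²≈) (∣p-q∣≤⇒p≤q+ (z * z) τ z²≈))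
   , N₁ ⊔ N₂ , λ n N≤n → below-lemma z (seq (√ t) n) (seq ρ n) ε
       (∣p-q∣≤⇒p≤q+ z (seq (√ t) n) (close N n (ℕ.m≤n⊔m N₀ N₁) (ℕ.m⊔n≤o⇒m≤o N₁ N₂ N≤n)))
       (below n (ℕ.m⊔n≤o⇒n≤o N₁ N₂ N≤n))
  where
  2ε≤1-lemma : ∀ τ ε → 0ℚ ≤ ε → 0ℚ ≤ τ → ε * (τ + τ + (1ℚ + 1ℚ + 1ℚ)) ≤ 1ℚ → ε + ε ≤ 1ℚ
  2ε≤1-lemma τ ε 0≤ε 0≤τ h = ≤-by
    ((1ℚ - ε * (τ + τ + (1ℚ + 1ℚ + 1ℚ))) + ε * (τ + τ + 1ℚ))
    (0≤diff h ⊕ 0≤ε ⊗ (0≤τ ⊕ 0≤τ ⊕ 0≤1))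
    (solve 2 (λ τ ε → let o = con 1ℚ in
      ε :+ ε :+ ((o :- ε :* (τ :+ τ :+ (o :+ o :+ o))) :+ ε :* (τ :+ τ :+ o)) := o) refl τ ε)
  1≤z-lemma : ∀ τ ε z → 0ℚ ≤ z → 1ℚ + 1ℚ ≤ τ → 0ℚ ≤ ε → ε + ε ≤ 1ℚ → τ ≤ z * z + ε → 1ℚ ≤ z
  1≤z-lemma τ ε z 0≤z 2≤τ 0≤ε 2ε≤1 h with ℚ.≤-total 1ℚ z
  ... | inj₁ 1≤z = 1≤z
  -- Here z² ≤ z, so z ≥ τ - ε ≥ 2 - 1/2.
  ... | inj₂ z≤1 = ≤-by
    (z * (1ℚ - z) + (z * z + ε - τ) + (τ - (1ℚ + 1ℚ)) + (1ℚ - (ε + ε)) + ε)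
    (0≤z ⊗ 0≤diff z≤1 ⊕ 0≤diff h ⊕ 0≤diff 2≤τ ⊕ 0≤diff 2ε≤1 ⊕ 0≤ε)
    (solve 3 (λ τ ε z → let o = con 1ℚ in
      o :+ (z :* (o :- z) :+ (z :* z :+ ε :- τ) :+ (τ :- (o :+ o)) :+ (o :- (ε :+ ε)) :+ ε) := z) refl τ ε z)
  square-lemma : ∀ τ ε z → 0ℚ ≤ ε → τ ≤ z * z + ε → z * z ≤ τ + ε →
    τ ≤ (z - (ε + ε)) * (z - (ε + ε)) + ε * (τ + τ + (1ℚ + 1ℚ + 1ℚ))
  square-lemma τ ε z 0≤ε lo hi = ≤-by
    ((z * z + ε - τ) + (ε + ε) * ((z - 1ℚ) * (z - 1ℚ)) + (ε + ε) * (τ + ε - z * z) + (ε + ε) * ε)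
    (0≤diff lo ⊕ (0≤ε ⊕ 0≤ε) ⊗ 0≤square (z - 1ℚ) ⊕ (0≤ε ⊕ 0≤ε) ⊗ 0≤diff hi ⊕ (0≤ε ⊕ 0≤ε) ⊗ 0≤ε)
    (solve 3 (λ τ ε z → let o = con 1ℚ in
      τ :+ ((z :* z :+ ε :- τ) :+ (ε :+ ε) :* ((z :- o) :* (z :- o)) :+ (ε :+ ε) :* (τ :+ ε :- z :* z) :+ (ε :+ ε) :* ε)
      := (z :- (ε :+ ε)) :* (z :- (ε :+ ε)) :+ ε :* (τ :+ τ :+ (o :+ o :+ o))) refl τ ε z)
  below-lemma : ∀ z w r ε → z ≤ w + ε → w ≤ r + ε → z - (ε + ε) ≤ r
  below-lemma z w r ε zw wr = ≤-by ((w + ε - z) + (r + ε - w)) (0≤diff zw ⊕ 0≤diff wr)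
    (solve 4 (λ z w r ε → z :- (ε :+ ε) :+ ((w :+ ε :- z) :+ (r :+ ε :- w)) := r) refl z w r ε)

-- With R = 2k + 3 and c = 1 / 4R, the coefficient (Q - 1)(Q² - t + 1) - 2(k + 1) of
-- maximum-bound is positive as soon as Q² is within c² of t.
module Gap (R c : ℚ) (1≤R : 1ℚ ≤ R) (0<c : 0ℚ < c) (4Rc≡1 : c * (R + R + (R + R)) ≡ 1ℚ) where

  0≤c : 0ℚ ≤ c
  0≤c = ℚ.<⇒≤ 0<c

  0≤R : 0ℚ ≤ R
  0≤R = ℚ.≤-trans 0≤1 1≤R

  0≤1-4Rc : 0ℚ ≤ 1ℚ - c * (R + R + (R + R))
  0≤1-4Rc = 0≤diff (ℚ.≤-reflexive 4Rc≡1)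

  c≤1 : c ≤ 1ℚ
  c≤1 = ≤-by ((1ℚ - c * (R + R + (R + R))) + c * ((R - 1ℚ) + (R + R + R)))
    (0≤1-4Rc ⊕ 0≤c ⊗ (0≤diff 1≤R ⊕ (0≤R ⊕ 0≤R ⊕ 0≤R)))
    (solve 2 (λ R c → let o = con 1ℚ in
      c :+ ((o :- c :* (R :+ R :+ (R :+ R))) :+ c :* ((R :- o) :+ (R :+ R :+ R))) := o) refl R c)

  c²≤1 : c * c ≤ 1ℚ
  c²≤1 = ℚ.≤-trans (ℚ.*-monoˡ-≤-nonNeg c {{nonNegative 0≤c}} c≤1)
    (ℚ.≤-trans (ℚ.≤-reflexive (ℚ.*-identityʳ c)) c≤1)

  module _ (Q t : ℚ) (0≤Q : 0ℚ ≤ Q) (R²<t : R * R + 1ℚ ≤ t) (t≤Q² : t ≤ Q * Q + c * c) where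

    -- (R + c)² is R² + 1/2 + c², while Q² is at least R² + 1 - c². The comparison needs 2c² ≤ 1/2 =
    -- 2Rc, that is c ≤ R.
    R+c≤Q : R + c ≤ Q
    R+c≤Q = square-cancel-≤ (0≤R ⊕ 0≤c) 0≤Q (≤-by
      ((Q * Q + c * c - t) + (t - (R * R + 1ℚ)) + (c + c) * (R - c) + (1ℚ - c * (R + R + (R + R))))
      (0≤diff t≤Q² ⊕ 0≤diff R²<t ⊕ (0≤c ⊕ 0≤c) ⊗ 0≤diff (ℚ.≤-trans c≤1 1≤R) ⊕ 0≤1-4Rc)
      (solve 4 (λ R c Q t → let o = con 1ℚ in
        (R :+ c) :* (R :+ c) :+ ((Q :* Q :+ c :* c :- t) :+ (t :- (R :* R :+ o)) :+ (c :+ c) :* (R :- c)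
          :+ (o :- c :* (R :+ R :+ (R :+ R)))) := Q :* Q) refl R c Q t))

    R≤Q : R ≤ Q
    R≤Q = ℚ.≤-trans (≤-by c 0≤c refl) R+c≤Q

    -- The factors are at least R - 1 + c and 1 - c². The gain c outweighs the loss c²(R - 1 + c)
    -- because Rc = 1/4; a margin of c²R is kept.
    gap-positive : 0ℚ < (Q - 1ℚ) * (Q * Q - t + 1ℚ) - (R - 1ℚ)
    gap-positive = ℚ.<-≤-trans (0<* (0<* 0<c 0<c) (ℚ.<-≤-trans (ℚ.positive⁻¹ 1ℚ) 1≤R)) (≤-by
      ((Q - 1ℚ) * (Q * Q + c * c - t) + (Q - (R + c)) * (1ℚ - c * c)
        + c * (1ℚ - c * (R + R + (R + R))) + c * c * (R + R) + c * c * (1ℚ - c))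
      (0≤diff (ℚ.≤-trans 1≤R R≤Q) ⊗ 0≤diff t≤Q² ⊕ 0≤diff R+c≤Q ⊗ 0≤diff c²≤1
        ⊕ 0≤c ⊗ 0≤1-4Rc ⊕ 0≤c ⊗ 0≤c ⊗ (0≤R ⊕ 0≤R) ⊕ 0≤c ⊗ 0≤c ⊗ 0≤diff c≤1)
      (solve 4 (λ R c Q t → let o = con 1ℚ in
        c :* c :* R :+ ((Q :- o) :* (Q :* Q :+ c :* c :- t) :+ (Q :- (R :+ c)) :* (o :- c :* c)
          :+ c :* (o :- c :* (R :+ R :+ (R :+ R))) :+ c :* c :* (R :+ R) :+ c :* c :* (o :- c))
        := (Q :- o) :* (Q :* Q :- t :+ o) :- (R :- o)) refl R c Q t))

gap-below-√ : ∀ t ρ R → 2 ℕ.≤ t → 1ℚ ≤ R → R * R + 1ℚ ≤ ι t → ρ ≥ √ t →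
  ∃ λ Q → R ≤ Q × 0ℚ < (Q - 1ℚ) * (Q * Q - ι t + 1ℚ) - (R - 1ℚ) × Eventually λ N → Q ≤ seq ρ N
gap-below-√ t ρ R 2≤t 1≤R R²<t √t≤ρ =
  let 0<R             = ℚ.<-≤-trans (ℚ.positive⁻¹ 1ℚ) 1≤R
      c , 0<c , 4Rc≡1 = quotient 1ℚ (R + R + (R + R)) (ℚ.positive⁻¹ 1ℚ)
                          (ℚ.+-mono-< (ℚ.+-mono-< 0<R 0<R) (ℚ.+-mono-< 0<R 0<R))
      Q , 0≤Q , t≤Q² , Q≤ρ = rational-below-√ t ρ (c * c) 2≤t (0<* 0<c 0<c)
                               (Gap.c²≤1 R c 1≤R 0<c 4Rc≡1) √t≤ρ
  in Q , Gap.R≤Q R c 1≤R 0<c 4Rc≡1 Q (ι t) 0≤Q R²<t t≤Q²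
       , Gap.gap-positive R c 1≤R 0<c 4Rc≡1 Q (ι t) 0≤Q R²<t t≤Q² , Q≤ρ

-- Real sums and finite families at a stage

seq-∑ : ∀ {n} (f : Fin n → ℝ) N {g : Fin n → ℚ} → (∀ i → seq (f i) N ≡ g i) → seq (∑ f) N ≡ sum g
seq-∑ {zero}  f N h = refl
seq-∑ {suc n} f N h = cong₂ _+_ (h zero) (seq-∑ (f ∘ suc) N (h ∘ suc))

eventually-all : ∀ {n} {P : Fin n → ℕ → Set} → (∀ i → Eventually (P i)) → Eventually λ N → ∀ i → P i N
eventually-all {zero}  h = 0 , λ _ _ ()
eventually-all {suc n} h with h zero | eventually-all (h ∘ suc)
... | N₀ , p | N₁ , q = N₀ ⊔ N₁ , λ where
  N N≤ zero    → p N (ℕ.m⊔n≤o⇒m≤o N₀ N₁ N≤)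
  N N≤ (suc i) → q N (ℕ.m⊔n≤o⇒n≤o N₀ N₁ N≤) i

-- Subgraphs and eigenvalues

lookup-injective : ∀ {A : Set} {xs : List A} → Unique xs → ∀ i j → lookup xs i ≡ lookup xs j → i ≡ j
lookup-injective (_  ∷ _) zero    zero    _  = refl
lookup-injective (x∉ ∷ _) zero    (suc j) eq = contradiction eq (All.lookup x∉ (∈-lookup j))
lookup-injective (x∉ ∷ _) (suc i) zero    eq = contradiction (sym eq) (All.lookup x∉ (∈-lookup i))
lookup-injective (_  ∷ p) (suc i) (suc j) eq = cong suc (lookup-injective p i j eq)

module _ {n} (G : Graph n) where

  neighbours : Fin n → List (Fin n)
  neighbours u = filter (λ v → adj G u v ≟ true) (allFin n)

  ι-length-neighbours : ∀ u → ι (length (neighbours u)) ≡ deg G u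
  ι-length-neighbours u = trans (ι-length-filter (λ v → adj G u v ≟ true) id)
    (sum-cong-≗ λ v → cong χ (does-≟-true (adj G u v)))
    where
    does-≟-true : ∀ b → does (b ≟ true) ≡ b
    does-≟-true true  = refl
    does-≟-true false = refl

  adjacent⇒≢ : ∀ {u v} → adj G u v ≡ true → u ≢ v
  adjacent⇒≢ {u} uv refl = contradiction (trans (sym uv) (irrefl G u)) λ ()

  -- The leaves are the first `t` listed neighbours, distinct because filtering `allFin n` creates
  -- no repetitions.
  star : ∀ {t} u → t ℕ.≤ length (neighbours u) → (K₁, t) ⊑ G
  star {t} u t≤ = f , (λ {i} {j} → f-inj i j) , edge
    where
    f : Fin (suc t) → Fin n
    f zero    = u
    f (suc i) = lookup (neighbours u) (inject≤ i t≤)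
    u~f : ∀ i → adj G u (f (suc i)) ≡ true
    u~f i = proj₂ (∈-filter⁻ (λ v → adj G u v ≟ true) {xs = allFin n} (∈-lookup (inject≤ i t≤)))
    f-inj : ∀ i j → f i ≡ f j → i ≡ j
    f-inj zero    zero    _  = refl
    f-inj zero    (suc j) eq = contradiction eq (adjacent⇒≢ (u~f j))
    f-inj (suc i) zero    eq = contradiction (sym eq) (adjacent⇒≢ (u~f i))
    f-inj (suc i) (suc j) eq = cong suc (Fin.inject≤-injective t≤ t≤ i j
      (lookup-injective (filter⁺ (λ v → adj G u v ≟ true) (allFin⁺ n)) _ _ eq))
    edge : ∀ i j → adj (K₁, t) i j ≡ true → adj G (f i) (f j) ≡ true
    edge zero    (suc j) _ = u~f j
    edge (suc i) zero    _ = trans (symm G _ u) (u~f i)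

  -- The cycle runs through u, v, j, w. Consecutive vertices differ by adjacency; the two diagonals
  -- need explicit hypotheses.
  four-cycle : ∀ {u j v w} → u ≢ j → v ≢ w → adj G u v ≡ true → adj G v j ≡ true →
    adj G u w ≡ true → adj G w j ≡ true → C₄ ⊑ G
  four-cycle {u} {j} {v} {w} u≢j v≢w uv vj uw wj = f , (λ {x} {y} → f-inj x y) , edge
    where
    f : Fin 4 → Fin n
    f 0F = u
    f 1F = v
    f 2F = j
    f 3F = w
    f-inj : ∀ x y → f x ≡ f y → x ≡ y
    f-inj 0F 0F _ = refl
    f-inj 1F 1F _ = refl
    f-inj 2F 2F _ = refl
    f-inj 3F 3F _ = refl
    f-inj 0F 1F e = contradiction e (adjacent⇒≢ uv)
    f-inj 0F 2F e = contradiction e u≢j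
    f-inj 0F 3F e = contradiction e (adjacent⇒≢ uw)
    f-inj 1F 2F e = contradiction e (adjacent⇒≢ vj)
    f-inj 1F 3F e = contradiction e v≢w
    f-inj 3F 2F e = contradiction e (adjacent⇒≢ wj)
    f-inj 1F 0F e = contradiction (sym e) (adjacent⇒≢ uv)
    f-inj 2F 0F e = contradiction (sym e) u≢j
    f-inj 3F 0F e = contradiction (sym e) (adjacent⇒≢ uw)
    f-inj 2F 1F e = contradiction (sym e) (adjacent⇒≢ vj)
    f-inj 3F 1F e = contradiction (sym e) v≢w
    f-inj 2F 3F e = contradiction (sym e) (adjacent⇒≢ wj)
    edge : ∀ x y → adj C₄ x y ≡ true → adj G (f x) (f y) ≡ true
    edge 0F 1F _ = uv
    edge 1F 2F _ = vj
    edge 1F 3F ()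
    edge 3F 3F ()
    edge 0F 3F _ = uw
    edge 3F 2F _ = wj
    edge 1F 0F _ = trans (symm G v u) uv
    edge 2F 1F _ = trans (symm G j v) vj
    edge 3F 0F _ = trans (symm G w u) uw
    edge 2F 3F _ = trans (symm G j w) wj

  -- A finite search over quadruples with decidable conditions makes the dichotomy constructive.
  C₄-or-amo : C₄ ⊑ G ⊎ AtMostOneCommonNeighbour G
  C₄-or-amo with Fin.any? (λ u → Fin.any? λ j → Fin.any? λ v → Fin.any? λ w →
      ¬? (u Fin.≟ j) ×-dec ¬? (v Fin.≟ w) ×-dec (adj G u v ≟ true) ×-dec (adj G v j ≟ true)
      ×-dec (adj G u w ≟ true) ×-dec (adj G w j ≟ true))
  ... | yes (u , j , v , w , u≢j , v≢w , uv , vj , uw , wj) = inj₁ (four-cycle u≢j v≢w uv vj uw wj)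
  ... | no none = inj₂ λ u j u≢j v w uv vj uw wj → decidable-stable (v Fin.≟ w)
    λ v≢w → none (u , j , v , w , u≢j , v≢w , uv , vj , uw , wj)

  -- Eigenvectors at a rational stage

  seq-*ᵥ : ∀ x i N → seq ((adjacencyMatrix G *ᵥ x) i) N ≡ sum (λ j → a G i j * seq (x j) N)
  seq-*ᵥ x i N = seq-∑ (λ j → adjacencyMatrix G i j Defs.* x j) N λ j → cong (_* seq (x j) N) (entry (adj G i j))
    where
    entry : ∀ b → seq (if b then 1ℝ else 0ℝ) N ≡ χ b
    entry true  = refl
    entry false = refl

  -- Since 0 ≤ Q ≤ r, `r` is its own absolute value, and the triangle inequality yields the
  -- hypothesis `Qy≤` of `Extremal` for |x|.
  ∣eigenvector∣ : ∀ (x : Fin n → ℚ) i r Q η → 0ℚ ≤ Q → Q ≤ r → ∣ sum (λ j → a G i j * x j) - r * x i ∣ ≤ η →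
    Q * ∣ x i ∣ ≤ sum (λ j → a G i j * ∣ x j ∣) + η
  ∣eigenvector∣ x i r Q η 0≤Q Q≤r h = begin
    Q * ∣ x i ∣                               ≤⟨ ℚ.*-monoʳ-≤-nonNeg ∣ x i ∣ {{nonNegative (ℚ.0≤∣p∣ (x i))}} Q≤r ⟩
    r * ∣ x i ∣                               ≡⟨ cong (_* ∣ x i ∣) (ℚ.0≤p⇒∣p∣≡p (ℚ.≤-trans 0≤Q Q≤r)) ⟨
    ∣ r ∣ * ∣ x i ∣                           ≡⟨ ℚ.∣p*q∣≡∣p∣*∣q∣ r (x i) ⟨
    ∣ r * x i ∣                               ≤⟨ ∣p-q∣≤⇒∣q∣≤∣p∣+ (sum (λ j → a G i j * x j)) (r * x i) h ⟩
    ∣ sum (λ j → a G i j * x j) ∣ + η         ≤⟨ ℚ.+-monoˡ-≤ η (∣sum∣≤sum∣∣ (λ j → a G i j * x j)) ⟩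
    sum (λ j → ∣ a G i j * x j ∣) + η         ≡⟨ cong (_+ η) (sum-cong-≗ λ j → trans (ℚ.∣p*q∣≡∣p∣*∣q∣ (a G i j) (x j))
                                                   (cong (_* ∣ x j ∣) (ℚ.0≤p⇒∣p∣≡p (0≤a G i j)))) ⟩
    sum (λ j → a G i j * ∣ x j ∣) + η         ∎
    where open ℚ.≤-Reasoning

  eigenvector-seq : ∀ x ρ → (∀ i → (adjacencyMatrix G *ᵥ x) i ≈ ρ Defs.* x i) → ∀ η → 0ℚ < η → ∀ i →
    Eventually λ N → ∣ sum (λ j → a G i j * seq (x j) N) - seq ρ N * seq (x i) N ∣ ≤ η
  eigenvector-seq x ρ eig η 0<η i = proj₁ (eig i η 0<η) , λ N N₀≤N →
    subst₂ (λ s p → ∣ s - p ∣ ≤ η) (seq-*ᵥ x i N) (seq-* N) (proj₂ (eig i η 0<η) N N₀≤N)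
    where
    seq-* : ∀ N → seq (ρ Defs.* x i) N ≡ seq ρ N * seq (x i) N
    seq-* N = refl

  eigenvector-vanishes : AtMostOneCommonNeighbour G → ∀ t k Q →
    sum (deg G) ≤ (t + k) + (t + k) → (∀ u → deg G u + 1ℚ ≤ t) → 1ℚ + 1ℚ + 1ℚ ≤ Q →
    0ℚ < (Q - 1ℚ) * (Q * Q - t + 1ℚ) - (k + k + (1ℚ + 1ℚ)) →
    ∀ x ρ → (Eventually λ N → Q ≤ seq ρ N) → (∀ i → (adjacencyMatrix G *ᵥ x) i ≈ ρ Defs.* x i) →
    ∀ i → x i ≈ 0ℝ
  eigenvector-vanishes amo t k Q D≤ d<t 3≤Q 0<κ x ρ (N₀ , Q≤ρ) eig i ε 0<ε
    = N₀ ⊔ N₁ , λ N N≤ → subst (λ p → ∣ p ∣ ≤ ε) (sym (ℚ.+-identityʳ (seq (x i) N))) (small N N≤)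
    where
    κ V K : ℚ
    κ = (Q - 1ℚ) * (Q * Q - t + 1ℚ) - (k + k + (1ℚ + 1ℚ))
    V = sum {n} (λ _ → 1ℚ)
    K = V + (Q - 1ℚ) * (V + Q)
    1≤Q : 1ℚ ≤ Q
    1≤Q = ℚ.≤-trans (≤-by {1ℚ} (1ℚ + 1ℚ) (0≤1 ⊕ 0≤1) refl) 3≤Q
    0≤V : 0ℚ ≤ V
    0≤V = 0≤sum {n} (λ _ → 0≤1)
    0≤K : 0ℚ ≤ K
    0≤K = 0≤V ⊕ 0≤diff {1ℚ} 1≤Q ⊗ (0≤V ⊕ ℚ.≤-trans 0≤1 1≤Q)
    0≤Q : 0ℚ ≤ Q
    0≤Q = ℚ.≤-trans 0≤1 1≤Q

    -- `η` must be fixed before the stage; `K` and `κ` permit this, as neither involves the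
    -- maximising vertex.
    ηs : ∃ λ η → 0ℚ < η × η * (K + 1ℚ) ≡ κ * ε
    ηs = quotient (κ * ε) (K + 1ℚ) (0<* 0<κ 0<ε) (ℚ.+-mono-≤-< 0≤K (ℚ.positive⁻¹ 1ℚ))
    η = proj₁ ηs
    0<η = proj₁ (proj₂ ηs)
    ηK≡κε = proj₂ (proj₂ ηs)

    stage : Eventually λ N → ∀ j → ∣ sum (λ l → a G j l * seq (x l) N) - seq ρ N * seq (x j) N ∣ ≤ η
    stage = eventually-all {P = λ j N → ∣ sum (λ l → a G j l * seq (x l) N) - seq ρ N * seq (x j) N ∣ ≤ η}
      (eigenvector-seq x ρ eig η 0<η)
    N₁ = proj₁ stage
    close = proj₂ stage

    small : ∀ N → N₀ ⊔ N₁ ℕ.≤ N → ∣ seq (x i) N ∣ ≤ ε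
    small N N≤ = ℚ.≤-trans (proj₂ top i)
      (Extremal.maximum-bound G amo y (λ j → ℚ.0≤∣p∣ (seq (x j) N)) (proj₁ top) (proj₂ top) Q η 0≤Q (ℚ.<⇒≤ 0<η)
        (λ j → ∣eigenvector∣ (λ l → seq (x l) N) j (seq ρ N) Q η 0≤Q
          (Q≤ρ N (ℕ.m⊔n≤o⇒m≤o N₀ N₁ N≤)) (close N (ℕ.m⊔n≤o⇒n≤o N₀ N₁ N≤) j))
        t k ε D≤ (d<t (proj₁ top)) 3≤Q 0<κ ηK≡κε)
      where
      y : Fin n → ℚ
      y j = ∣ seq (x j) N ∣
      -- The maximising vertex may change with the stage, so it is chosen anew for each `N`.
      top : ∃ λ u → ∀ j → y j ≤ y u
      top = argmax y i

  -- Eigenvalues when all degrees are below t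

  module EigenvalueBound (k t : ℕ) (m≡ : edgeCount G ≡ t ℕ.+ k) (deg< : ∀ u → length (neighbours u) ℕ.< t)
    (R²<t : (2 ℕ.* k ℕ.+ 3) ℕ.* (2 ℕ.* k ℕ.+ 3) ℕ.+ 1 ℕ.≤ t) where

    R : ℚ
    R = ι (2 ℕ.* k ℕ.+ 3)

    3≤R : 1ℚ + 1ℚ + 1ℚ ≤ R
    3≤R = ι-mono-≤ {3} {2 ℕ.* k ℕ.+ 3} (ℕ.m≤n+m 3 (2 ℕ.* k))

    1≤R : 1ℚ ≤ R
    1≤R = ι-mono-≤ {1} {2 ℕ.* k ℕ.+ 3} (ℕ.≤-trans (ℕ.m≤m+n 1 2) (ℕ.m≤n+m 3 (2 ℕ.* k)))

    R²<t′ : R * R + 1ℚ ≤ ι t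
    R²<t′ = ℚ.≤-trans (ℚ.≤-reflexive (sym (trans (ι-+ ((2 ℕ.* k ℕ.+ 3) ℕ.* (2 ℕ.* k ℕ.+ 3)) 1)
      (cong (_+ 1ℚ) (ι-* (2 ℕ.* k ℕ.+ 3) (2 ℕ.* k ℕ.+ 3)))))) (ι-mono-≤ {(2 ℕ.* k ℕ.+ 3) ℕ.* (2 ℕ.* k ℕ.+ 3) ℕ.+ 1} {t} R²<t)

    2≤t : 2 ℕ.≤ t
    2≤t = ℕ.≤-trans (ℕ.+-monoˡ-≤ 1 (ℕ.*-mono-≤ {1} {2 ℕ.* k ℕ.+ 3} {1} {2 ℕ.* k ℕ.+ 3} 1≤ 1≤)) R²<t
      where 1≤ = ℕ.≤-trans (ℕ.m≤m+n 1 2) (ℕ.m≤n+m 3 (2 ℕ.* k))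

    -- Matches the term subtracted in `Gap` with the one subtracted in `maximum-bound`; this is what
    -- fixes R = 2k + 3.
    R-1≡ : R - 1ℚ ≡ ι k + ι k + (1ℚ + 1ℚ)
    R-1≡ = trans (cong (λ r → ι r - 1ℚ) (reorder k))
      (trans (cong (_- 1ℚ) (trans (ι-+ (k ℕ.+ k) 3) (cong (_+ ι 3) (ι-+ k k))))
        (solve 1 (λ k → k :+ k :+ con (ι 3) :- con 1ℚ := k :+ k :+ (con 1ℚ :+ con 1ℚ)) refl (ι k)))
      where
      reorder : ∀ k → 2 ℕ.* k ℕ.+ 3 ≡ k ℕ.+ k ℕ.+ 3
      reorder = ℕ-Ring.solve-∀

    D≤ : sum (deg G) ≤ (ι t + ι k) + (ι t + ι k)
    D≤ = ℚ.≤-trans (handshake G) (ℚ.≤-reflexive (cong (λ s → s + s) (trans (cong ι m≡) (ι-+ t k))))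

    d<t : ∀ u → deg G u + 1ℚ ≤ ι t
    d<t u = ℚ.≤-trans (ℚ.≤-reflexive (trans (cong (_+ 1ℚ) (sym (ι-length-neighbours u)))
      (trans (sym (ι-+ (length (neighbours u)) 1)) (cong ι (ℕ.+-comm (length (neighbours u)) 1)))))
      (ι-mono-≤ {suc (length (neighbours u))} {t} (deg< u))

    no-eigenvalue-above-√t : AtMostOneCommonNeighbour G → ∀ ρ → ρ ≥ √ t → ¬ IsEigenvalue (adjacencyMatrix G) ρ
    no-eigenvalue-above-√t amo ρ √t≤ρ (x , x≉0 , eig) = x≉0 (vanishes (gap-below-√ t ρ R 2≤t 1≤R R²<t′ √t≤ρ))
      where
      vanishes : (∃ λ Q → R ≤ Q × 0ℚ < (Q - 1ℚ) * (Q * Q - ι t + 1ℚ) - (R - 1ℚ) × Eventually λ N → Q ≤ seq ρ N) →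
        ∀ i → x i ≈ 0ℝ
      vanishes (Q , R≤Q , 0<κ , Q≤ρ) = eigenvector-vanishes amo (ι t) (ι k) Q D≤ d<t (ℚ.≤-trans 3≤R R≤Q)
        (subst (λ r → 0ℚ < (Q - 1ℚ) * (Q * Q - ι t + 1ℚ) - r) R-1≡ 0<κ) x ρ Q≤ρ eig

-- Case distinction: a 4-cycle, a vertex of degree at least m - k, or neither

theorem1p4 : ∀ (k n m : ℕ) (G : Graph n) →
    edgeCount G ≡ m →
    m ℕ.≥ ((k ℕ.^ 2 ℕ.+ 2 ℕ.* k ℕ.+ 2) ℕ.^ 2 ℕ.+ k ℕ.+ 1) ⊔ ((2 ℕ.* k ℕ.+ 3) ℕ.^ 2 ℕ.+ k ℕ.+ 1) →
    ∀ (ρ : ℝ) → IsSpectralRadius G ρ →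
    ρ ≥ √ (m ∸ k) →
    ((K₁, (m ∸ k)) ⊑ G) ⊎ (C₄ ⊑ G)
theorem1p4 k n m G e≡m m≥ ρ (isEigenvalue , _) √t≤ρ =
  Sum.[ inj₂ , (λ amo → star-or-contradiction amo (Fin.any? λ u → m ∸ k ℕ.≤? length (neighbours G u))) ]′ (C₄-or-amo G)
  where
  R = 2 ℕ.* k ℕ.+ 3
  R²+1+k≤m : R ℕ.* R ℕ.+ 1 ℕ.+ k ℕ.≤ m
  R²+1+k≤m = subst (ℕ._≤ m) (reorder R k)
    (ℕ.m⊔n≤o⇒n≤o ((k ℕ.^ 2 ℕ.+ 2 ℕ.* k ℕ.+ 2) ℕ.^ 2 ℕ.+ k ℕ.+ 1) _ m≥)
    where
    -- `R ℕ.^ 2` computes to R * (R * 1), the shape on the left.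
    reorder : ∀ r k → r ℕ.* (r ℕ.* 1) ℕ.+ k ℕ.+ 1 ≡ r ℕ.* r ℕ.+ 1 ℕ.+ k
    reorder = ℕ-Ring.solve-∀
  -- Makes `m ∸ k` a true difference, so that the edge count splits as (m ∸ k) + k.
  k≤m : k ℕ.≤ m
  k≤m = ℕ.≤-trans (ℕ.m≤n+m k (R ℕ.* R ℕ.+ 1)) R²+1+k≤m
  R²<t : R ℕ.* R ℕ.+ 1 ℕ.≤ m ∸ k
  R²<t = ℕ.m+n≤o⇒m≤o∸n (R ℕ.* R ℕ.+ 1) R²+1+k≤m
  star-or-contradiction : AtMostOneCommonNeighbour G → Dec (∃ λ u → m ∸ k ℕ.≤ length (neighbours G u)) →
    ((K₁, (m ∸ k)) ⊑ G) ⊎ (C₄ ⊑ G)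
  star-or-contradiction _   (yes (u , t≤)) = inj₁ (star G u t≤)
  star-or-contradiction amo (no none)      = contradiction isEigenvalue
    (EigenvalueBound.no-eigenvalue-above-√t G k (m ∸ k) (trans e≡m (sym (ℕ.m∸n+n≡m k≤m)))
      (λ u → ℕ.≰⇒> λ t≤ → none (u , t≤)) R²<t amo ρ √t≤ρ)
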